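{- Let $k \geq \ell \geq 2$ be integers with $\ell\le n$ and $k\le\frac{q^n-1}{q-1}$. Then $\Gamma_{n}^{(k,\ell)}={\rm Ind}^{{\rm pro}}_q(n,k,\ell)$.
   Context: Let $\mathcal{K}$ be a field with a discrete valuation $\nu$, valuation ring $\mathcal{O}$, maximal ideal $\mathfrak{m}$, and finite residue field $\mathcal{O}/\mathfrak{m}\cong\mathbb{F}_q$. Put $|\lambda|=q^{ -\nu(\lambda)}$ and $\|\mathbf{v}\|=\max_{i}|v_i|$ on $\mathcal{K}^n$. Nonzero vectors $\mathbf{u}_1,\dots,\mathbf{u}_m$ are orthogonal if $\|\sum_i\lambda_i\mathbf{u}_i\|=\max_i\|\lambda_i\mathbf{u}_i\|$ for all $\lambda_i\in\mathcal{K}$; a finite set is orthogonal if its elements are; a set is weakly orthogonal if any two distinct elements are orthogonal. A weakly orthogonal set $S\subseteq\mathcal{K}^n\setminus\{\mathbf 0\}$ is $(k,\ell)$-strongly orthogonal if every $E\subseteq S$ of size $k$ contains an orthogonal subset of size $\ell$; $\Gamma_n^{(k,\ell)}$ is the maximum size of such a set. For $1\le\ell\le k\le\frac{q^n-1}{q-1}$ with $\ell\le n$, a set $S\subseteq\mathbb{P}^{n-1}(\mathbb{F}_q)$ is $(k,\ell)$-pro-independent if every $X\subseteq S$ of size $k$ contains $\ell$ linearly independent points (i.e. the span of (lifts of) $X$ in $\mathbb{F}_q^n$ has dimension $\ge\ell$); $\operatorname{Ind}^{\rm pro}_q(n,k,\ell)$ is the maximum size of such $S$. -}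

module Defs where

open import Level using (Level; _⊔_) renaming (suc to lsuc)
open import Algebra.Bundles using (CommutativeRing)
open import Data.Nat as ℕ using (ℕ; zero; suc)
open import Data.Integer as ℤ using (ℤ)
open import Data.Fin using (Fin; zero; suc)
open import Data.Product using (Σ; ∃; _×_; _,_)
open import Relation.Nullary using (¬_)
open import Relation.Binary.PropositionalEquality using (_≡_)
open import Function using (_∘_)

record Field c ℓ : Set (lsuc (c ⊔ ℓ)) where
  field
    commutativeRing : CommutativeRing c ℓ
  open CommutativeRing commutativeRing public
  field
    0≉1     : ¬ (0# ≈ 1#)
    inverse : ∀ x → ¬ (x ≈ 0#) → ∃ λ y → (x * y) ≈ 1#

InjectiveF : ∀ {a b} → (Fin a → Fin b) → Set
InjectiveF {a} f = ∀ (i j : Fin a) → f i ≡ f j → i ≡ j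

data ℤ∞ : Set where
  fin : ℤ → ℤ∞
  ∞   : ℤ∞

_+∞_ : ℤ∞ → ℤ∞ → ℤ∞
fin a +∞ fin b = fin (a ℤ.+ b)
fin _ +∞ ∞     = ∞
∞     +∞ _     = ∞

data _≤∞_ : ℤ∞ → ℤ∞ → Set where
  fin≤fin : ∀ {a b} → a ℤ.≤ b → fin a ≤∞ fin b
  _≤∞∞    : ∀ x → x ≤∞ ∞

min∞ : ℤ∞ → ℤ∞ → ℤ∞
min∞ (fin a) (fin b) = fin (a ℤ.⊓ b)
min∞ (fin a) ∞       = fin a
min∞ ∞       y       = y

minF : ∀ m → (Fin m → ℤ∞) → ℤ∞
minF zero    f = ∞
minF (suc m) f = min∞ (f zero) (minF m (f ∘ suc))

module LinAlg {c ℓ} (K : Field c ℓ) where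
  open Field K using (Carrier; _≈_; _+_; _*_; 0#)

  Vecᴷ : ℕ → Set c
  Vecᴷ n = Fin n → Carrier

  _≈v_ : ∀ {n} → Vecᴷ n → Vecᴷ n → Set ℓ
  u ≈v v = ∀ i → u i ≈ v i

  0v : ∀ {n} → Vecᴷ n
  0v _ = 0#

  _+v_ : ∀ {n} → Vecᴷ n → Vecᴷ n → Vecᴷ n
  (u +v v) i = u i + v i

  _·v_ : ∀ {n} → Carrier → Vecᴷ n → Vecᴷ n
  (a ·v v) i = a * v i

  lincomb : ∀ {n} m → (Fin m → Carrier) → (Fin m → Vecᴷ n) → Vecᴷ n
  lincomb zero    λs us = 0v
  lincomb (suc m) λs us = (λs zero ·v us zero) +v lincomb m (λs ∘ suc) (us ∘ suc)

  Distinct : ∀ {n N} → (Fin N → Vecᴷ n) → Set ℓ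
  Distinct {N = N} S = ∀ (i j : Fin N) → S i ≈v S j → i ≡ j

  NonZero : ∀ {n} → Vecᴷ n → Set ℓ
  NonZero v = ¬ (v ≈v 0v)

  LinIndep : ∀ {n m} → (Fin m → Vecᴷ n) → Set (c ⊔ ℓ)
  LinIndep {m = m} vs = ∀ (cs : Fin m → Carrier) → lincomb m cs vs ≈v 0v → ∀ j → cs j ≈ 0#

record DiscreteValuation {c ℓ} (K : Field c ℓ) : Set (c ⊔ ℓ) where
  open Field K using (Carrier; _≈_; _+_; _*_; 0#)
  field
    ν      : Carrier → ℤ∞
    ν-cong : ∀ {x y} → x ≈ y → ν x ≡ ν y
    ν-∞⇒0  : ∀ x → ν x ≡ ∞ → x ≈ 0#
    ν-0    : ν 0# ≡ ∞
    ν-*    : ∀ x y → ν (x * y) ≡ ν x +∞ ν y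
    ν-+    : ∀ x y → min∞ (ν x) (ν y) ≤∞ ν (x + y)
    ν-surj : ∀ (z : ℤ) → ∃ λ x → ν x ≡ fin z

module Valued {c ℓ} (K : Field c ℓ) (V : DiscreteValuation K) where
  open Field K using (Carrier; _≈_; _+_; _*_; -_; 0#)
  open DiscreteValuation V
  open LinAlg K

  In𝒪 : Carrier → Set
  In𝒪 x = fin (ℤ.+ 0) ≤∞ ν x

  In𝔪 : Carrier → Set
  In𝔪 x = fin (ℤ.+ 1) ≤∞ ν x

  -- the residue field 𝒪/𝔪 has exactly q elements:
  -- representatives r₀,…,r_{q-1} ∈ 𝒪, one in each class mod 𝔪
  ResidueCard : ℕ → Set c
  ResidueCard q = Σ (Fin q → Carrier) λ r →
      (∀ i → In𝒪 (r i))
    × (∀ x → In𝒪 x → ∃ λ i → In𝔪 (x + - r i))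
    × (∀ i j → In𝔪 (r i + - r j) → i ≡ j)

  -- ‖v‖ = max_i |v_i| = q^{-νv v},  where νv v = min_i ν(v_i)
  νv : ∀ {n} → Vecᴷ n → ℤ∞
  νv {n} v = minF n (λ i → ν (v i))

  -- orthogonality of a finite family:
  -- ‖Σ λ_i u_i‖ = max_i ‖λ_i u_i‖  ⇔  νv (Σ λ_i u_i) = min_i νv (λ_i u_i)
  -- (since t ↦ q^{-t} is strictly decreasing, ∞ ↦ 0)
  Orthogonal : ∀ {n m} → (Fin m → Vecᴷ n) → Set (c ⊔ ℓ)
  Orthogonal {n} {m} us =
      (∀ i → NonZero (us i))
    × (∀ (λs : Fin m → Carrier) →
         νv (lincomb m λs us) ≡ minF m (λ i → νv (λs i ·v us i)))

  pair : ∀ {n} → Vecᴷ n → Vecᴷ n → Fin 2 → Vecᴷ n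
  pair u v zero       = u
  pair u v (suc zero) = v

  WeaklyOrthogonal : ∀ {n N} → (Fin N → Vecᴷ n) → Set (c ⊔ ℓ)
  WeaklyOrthogonal {N = N} S = ∀ (i j : Fin N) → ¬ (i ≡ j) → Orthogonal (pair (S i) (S j))

  StronglyOrthogonal : ∀ {n N} → ℕ → ℕ → (Fin N → Vecᴷ n) → Set (c ⊔ ℓ)
  StronglyOrthogonal {N = N} k l S =
      (∀ i → NonZero (S i))
    × WeaklyOrthogonal S
    × (∀ (e : Fin k → Fin N) → InjectiveF e →
         ∃ λ (f : Fin l → Fin k) → InjectiveF f × Orthogonal (S ∘ e ∘ f))

  IsΓ : ℕ → ℕ → ℕ → ℕ → Set (c ⊔ ℓ)
  IsΓ n k l N =
      (∃ λ (S : Fin N → Vecᴷ n) → Distinct S × StronglyOrthogonal k l S)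
    × (∀ M (S : Fin M → Vecᴷ n) → Distinct S → StronglyOrthogonal k l S → M ℕ.≤ N)

module Projective {c ℓ} (F : Field c ℓ) where
  open Field F using (Carrier; _≈_)
  open LinAlg F

  HasCard : ℕ → Set (c ⊔ ℓ)
  HasCard q = Σ (Fin q → Carrier) λ e →
    (∀ x → ∃ λ i → x ≈ e i) × (∀ i j → e i ≈ e j → i ≡ j)

  -- a set of N points of ℙ^{n-1}(F), given by nonzero representatives,
  -- pairwise distinct as projective points
  ProjPoints : ∀ {n N} → (Fin N → Vecᴷ n) → Set (c ⊔ ℓ)
  ProjPoints {N = N} P =
      (∀ i → NonZero (P i))
    × (∀ (i j : Fin N) (a : Carrier) → P i ≈v (a ·v P j) → i ≡ j)

  ProIndependent : ∀ {n N} → ℕ → ℕ → (Fin N → Vecᴷ n) → Set (c ⊔ ℓ)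
  ProIndependent {N = N} k l P =
    ∀ (e : Fin k → Fin N) → InjectiveF e →
      ∃ λ (f : Fin l → Fin k) → InjectiveF f × LinIndep (P ∘ e ∘ f)

  IsIndPro : ℕ → ℕ → ℕ → ℕ → Set (c ⊔ ℓ)
  IsIndPro n k l N =
      (∃ λ (P : Fin N → Vecᴷ n) → ProjPoints P × ProIndependent k l P)
    × (∀ M (P : Fin M → Vecᴷ n) → ProjPoints P → ProIndependent k l P → M ℕ.≤ N)

{-# OPTIONS --safe #-}
module Submission where

-- Scale every vector of a weakly orthogonal set to norm 1 and reduce it modulo 𝔪. A family of norm-1
-- vectors is orthogonal iff its reduction is linearly independent over the residue field κ, so
-- strongly orthogonal sets correspond to pro-independent sets over κ, with the entries themselves
-- as lifts.
--
-- F is only known to have as many elements as L = κ, so the two are shown to be isomorphic. Let G ⊆ F × L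
-- be the graph of a homomorphism from a subring of F to L, and x ∈ F. If for every y ∈ L some
-- P_y ∈ G[X] had P_y(x) = 0 and P_y(y) ≠ 0, then V = ∏_y (1 - P_y^(q-1)), reduced modulo X^q - X, would
-- vanish on all of L, hence have zero coefficients, although V(x) = 1. So G extends to x. This
-- argument is by contradiction, and an actual isomorphism is then found among the q^q maps. The
-- induction starts at the prime ring: if n·1 = 0 in F then q ∣ n^q, whence (n·1)^q = 0 in L.

open import Defs
open import Level using (Level; _⊔_; 0ℓ; Lift; lift)
open import Algebra.Bundles using (CommutativeMonoid; CommutativeRing; CommutativeSemiring)
import Algebra.Construct.DirectProduct as DirectProduct
import Algebra.Properties.AbelianGroup as AbelianGroupProperties
import Algebra.Properties.CommutativeMonoid.Sum as MonoidSum
import Algebra.Properties.Group as GroupProperties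
import Algebra.Properties.Ring as RingProperties
import Algebra.Properties.Semiring.Exp as SemiringExp
import Algebra.Properties.Semiring.Mult as SemiringMult
import Algebra.Solver.Ring.NaturalCoefficients.Default as NaturalCoefficients
open import Data.Empty using (⊥-elim)
open import Data.Fin as Fin using (Fin; zero; suc; toℕ; fromℕ; inject₁; punchOut; finToFun; funToFin)
open import Data.Fin.Permutation using (Permutation′; permutation)
open import Data.Fin.Properties using (any?; all?; finToFun-funToFin; injective⇒≤; punchInᵢ≢i;
  punchOut-injective; suc-injective; toℕ-fromℕ; toℕ-inject₁)
open import Data.Integer as ℤ using (ℤ)
import Data.Integer.Properties as ℤ
open import Data.Nat as ℕ using (ℕ; zero; suc; _≤_)
import Data.Nat.Properties as ℕ
open import Data.Product using (Σ; ∃; _×_; _,_; proj₁; proj₂)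
open import Data.Sum using (inj₁; inj₂)
open import Data.Vec.Functional using (removeAt; replicate)
open import Function using (_∘_; id)
import Relation.Binary.Reasoning.Setoid as SetoidReasoning
open import Relation.Binary.PropositionalEquality as ≡ using (_≡_; _≢_)
open import Relation.Nullary using (¬_; Dec; yes; no)
open import Relation.Nullary.Decidable using (map′; decidable-stable; _×-dec_; _→-dec_; ¬?)

-- Neither maximum is known in advance, so the two sides are compared size by size: for every M, a
-- strongly orthogonal set of M vectors exists iff a pro-independent set of M points over F does.
-- The common N is then found by search over F, which is finite; K is never searched. Choosing the
-- image y of x as a root of a minimal polynomial would call for decisions about the subring, which
-- is only a predicate here. Instead y is required to satisfy every relation that x satisfies.
-- Refuting each y yields the polynomials P_y only under double negation; this is harmless, since
-- being a homomorphism is decidable for a finite table of values. Reduction modulo X^q - X is sound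
-- in F × L because z^q = z holds in both factors. The coefficients of V vanish in L first;
-- injectivity of the partial homomorphism (`0↤0`) brings this back to F, where V(x) = 1.

-- Finite search

record Enumeration {a r} {A : Set a} (_∼_ : A → A → Set r) (N : ℕ) : Set (a ⊔ r) where
  constructor enumerated
  field
    enum  : Fin N → A
    cover : ∀ x → ∃ λ i → x ∼ enum i

open Enumeration

∃-dec : ∀ {a r p} {A : Set a} {_∼_ : A → A → Set r} {N : ℕ} → Enumeration _∼_ N →
  {P : A → Set p} → (∀ {x y} → x ∼ y → P x → P y) → (∀ x → Dec (P x)) → Dec (∃ P)
∃-dec E resp P? =
  map′ (λ (i , p) → enum E i , p)
       (λ (x , p) → proj₁ (cover E x) , resp (proj₂ (cover E x)) p)
       (any? (P? ∘ enum E))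

∀-dec : ∀ {a r p} {A : Set a} {_∼_ : A → A → Set r} {N : ℕ} → Enumeration _∼_ N →
  {P : A → Set p} → (∀ {x y} → x ∼ y → P y → P x) → (∀ x → Dec (P x)) → Dec (∀ x → P x)
∀-dec E resp P? =
  map′ (λ h x → resp (proj₂ (cover E x)) (h _)) (λ h i → h (enum E i)) (all? (P? ∘ enum E))

Fin-enumeration : ∀ N → Enumeration {A = Fin N} _≡_ N
Fin-enumeration N = enumerated (λ i → i) λ i → i , ≡.refl

-- Functions are compared pointwise, which is all that `finToFun-funToFin` provides. Iterating the
-- construction makes families of vectors searchable.
→-enumeration : ∀ {a r} {A : Set a} {_∼_ : A → A → Set r} {N : ℕ} → Enumeration _∼_ N →
  ∀ m → Enumeration {A = Fin m → A} (λ f g → ∀ i → f i ∼ g i) (N ℕ.^ m)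
→-enumeration {_∼_ = _∼_} E m = enumerated (λ c → enum E ∘ finToFun c) λ f →
  funToFin (index ∘ f) ,
  λ i → ≡.subst (λ j → f i ∼ enum E j) (≡.sym (finToFun-funToFin (index ∘ f) i)) (proj₂ (cover E (f i)))
  where
  index : _ → Fin _
  index x = proj₁ (cover E x)

-- The search descends from the bound, so `B` may fail at sizes below one where it holds; `B 0` is
-- the fallback when everything above is refuted.
maximum : ∀ {p} {B : ℕ → Set p} → (∀ M → Dec (B M)) → B 0 → ∀ b → (∀ M → B M → M ≤ b) →
  ∃ λ N → B N × (∀ M → B M → M ≤ N)
maximum B? B0 zero bound = 0 , B0 , bound
maximum {B = B} B? B0 (suc b) bound with B? (suc b)
... | yes Bb = suc b , Bb , bound
... | no ¬Bb = maximum B? B0 b below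
  where
  below : ∀ M → B M → M ≤ b
  below M BM with ℕ.m≤n⇒m<n∨m≡n (bound M BM)
  ... | inj₁ M<1+b  = ℕ.≤-pred M<1+b
  ... | inj₂ ≡.refl = ⊥-elim (¬Bb BM)

-- Sums and products over a finite field

module _ {c ℓ} (M : CommutativeMonoid c ℓ) where
  open CommutativeMonoid M
  open MonoidSum M
  open SetoidReasoning setoid

  sum-except-one : ∀ {m} (t : Fin (suc m) → Carrier) (i : Fin (suc m)) {x} →
    (∀ j → j ≢ i → t j ≈ x) → sum t ≈ t i ∙ sum (replicate m x)
  sum-except-one {m} t i {x} t≈x = begin
    sum t                      ≈⟨ sum-remove t ⟩
    t i ∙ sum (removeAt t i)   ≈⟨ ∙-congˡ (sum-cong-≋ λ j → t≈x _ (punchInᵢ≢i i j)) ⟩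
    t i ∙ sum (replicate m x)  ∎

module FieldProperties {c ℓ} (F : Field c ℓ) where
  open Field F hiding (zero)
  open SetoidReasoning setoid
  open SemiringExp semiring using (_^_)

  zero-product : ∀ {x y} → ¬ x ≈ 0# → x * y ≈ 0# → y ≈ 0#
  zero-product {x} {y} x≉0 xy≈0 with inverse x x≉0
  ... | x′ , xx′≈1 = begin
    y             ≈⟨ *-identityˡ y ⟨
    1# * y        ≈⟨ *-congʳ (trans (sym xx′≈1) (*-comm x x′)) ⟩
    x′ * x * y    ≈⟨ *-assoc x′ x y ⟩
    x′ * (x * y)  ≈⟨ *-congˡ xy≈0 ⟩
    x′ * 0#       ≈⟨ zeroʳ x′ ⟩
    0#            ∎

  *-≉0 : ∀ {x y} → ¬ x ≈ 0# → ¬ y ≈ 0# → ¬ x * y ≈ 0#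
  *-≉0 x≉0 y≉0 = y≉0 ∘ zero-product x≉0

  1≉0 : ¬ 1# ≈ 0#
  1≉0 = 0≉1 ∘ sym

  ^-≉0 : ∀ {x} n → ¬ x ≈ 0# → ¬ x ^ n ≈ 0#
  ^-≉0 zero    x≉0 = 1≉0
  ^-≉0 (suc n) x≉0 = *-≉0 x≉0 (^-≉0 n x≉0)

  *-cancelʳ-1 : ∀ {x y} → ¬ y ≈ 0# → x * y ≈ y → x ≈ 1#
  *-cancelʳ-1 {x} {y} y≉0 xy≈y with inverse y y≉0
  ... | y′ , yy′≈1 = begin
    x              ≈⟨ *-identityʳ x ⟨
    x * 1#         ≈⟨ *-congˡ yy′≈1 ⟨
    x * (y * y′)   ≈⟨ *-assoc x y y′ ⟨
    x * y * y′     ≈⟨ *-congʳ xy≈y ⟩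
    y * y′         ≈⟨ yy′≈1 ⟩
    1#             ∎

-- The form `2 + m` turns the exponent q - 1 into `suc m` and exposes the two lowest coefficients of
-- a polynomial of length q to pattern matching.
module FiniteField {c ℓ} (F : Field c ℓ) (m : ℕ) (card : Projective.HasCard F (2 ℕ.+ m)) where
  open Field F hiding (zero)
  open FieldProperties F
  open GroupProperties +-group using (x≈y⇒x∙y⁻¹≈ε; identityʳ-unique; //-rightDividesˡ; //-rightDividesʳ)
  open SemiringMult semiring renaming (_×_ to _·_)
  open SemiringExp semiring using (_^_)

  q : ℕ
  q = 2 ℕ.+ m

  element : Fin q → Carrier
  element = proj₁ card

  index : Carrier → Fin q
  index x = proj₁ (proj₁ (proj₂ card) x)

  element-index : ∀ x → x ≈ element (index x)
  element-index x = proj₂ (proj₁ (proj₂ card) x)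

  element-injective : ∀ i j → element i ≈ element j → i ≡ j
  element-injective = proj₂ (proj₂ card)

  index-cong : ∀ {x y} → x ≈ y → index x ≡ index y
  index-cong {x} {y} x≈y = element-injective _ _
    (trans (sym (element-index x)) (trans x≈y (element-index y)))

  index-element : ∀ i → index (element i) ≡ i
  index-element i = element-injective _ _ (sym (element-index (element i)))

  infix 4 _≟_
  _≟_ : ∀ x y → Dec (x ≈ y)
  x ≟ y = map′ (λ eq → trans (element-index x) (trans (reflexive (≡.cong element eq)) (sym (element-index y))))
               index-cong (index x Fin.≟ index y)

  bijection⇒permutation : (f g : Carrier → Carrier) → (∀ {x y} → x ≈ y → f x ≈ f y) →
    (∀ {x y} → x ≈ y → g x ≈ g y) → (∀ x → f (g x) ≈ x) → (∀ x → g (f x) ≈ x) → Permutation′ q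
  bijection⇒permutation f g f-cong g-cong fg gf = permutation (index ∘ f ∘ element) (index ∘ g ∘ element)
    (λ i → ≡.trans (index-cong (trans (f-cong (sym (element-index _))) (fg _))) (index-element i))
    (λ i → ≡.trans (index-cong (trans (g-cong (sym (element-index _))) (gf _))) (index-element i))

  module _ {a b} (M : CommutativeMonoid a b) where
    private module M = CommutativeMonoid M
    open MonoidSum M using (sum; sum-permute; sum-cong-≋)

    sum-bijection : {h : Carrier → M.Carrier} → (∀ {x y} → x ≈ y → h x M.≈ h y) →
      (f g : Carrier → Carrier) → (∀ {x y} → x ≈ y → f x ≈ f y) → (∀ {x y} → x ≈ y → g x ≈ g y) →
      (∀ x → f (g x) ≈ x) → (∀ x → g (f x) ≈ x) → sum (h ∘ element) M.≈ sum (h ∘ f ∘ element)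
    sum-bijection {h} h-cong f g f-cong g-cong fg gf =
      M.trans (sum-permute (h ∘ element) (bijection⇒permutation f g f-cong g-cong fg gf))
              (sum-cong-≋ {q} λ i → h-cong (sym (element-index (f (element i)))))

    sum-translation : {h : Carrier → M.Carrier} → (∀ {x y} → x ≈ y → h x M.≈ h y) →
      ∀ a → sum (h ∘ element) M.≈ sum (λ i → h (element i + a))
    sum-translation h-cong a = sum-bijection h-cong (_+ a) (_- a) +-congʳ +-congʳ
      (//-rightDividesˡ a) (//-rightDividesʳ a)

  -- Translation by 1 permutes the field, so the sum s of all elements satisfies s + q·1 = s.
  q·1≈0 : q · 1# ≈ 0#
  q·1≈0 = identityʳ-unique (sum element) (q · 1#) (begin
    sum element + q · 1#                 ≈⟨ +-congˡ (sum-replicate q) ⟨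
    sum element + sum (replicate q 1#)   ≈⟨ ∑-distrib-+ element (replicate q 1#) ⟨
    sum (λ i → element i + 1#)           ≈⟨ sum-translation +-commutativeMonoid id 1# ⟨
    sum element                          ∎)
    where
    open MonoidSum +-commutativeMonoid using (sum; sum-replicate; ∑-distrib-+)
    open SetoidReasoning setoid

  -- Multiplication by x permutes the nonzero elements; zero is replaced by 1 in the products.
  x^[q-1]≈1 : ∀ {x} → ¬ x ≈ 0# → x ^ (suc m) ≈ 1#
  x^[q-1]≈1 {x} x≉0 with inverse x x≉0
  ... | x′ , xx′≈1 = *-cancelʳ-1 (product-≉0 (unit ∘ element) (λ i → unit-≉0 (element i))) (begin
    x ^ suc m * product (unit ∘ element)                ≈⟨ *-congʳ x^[q-1] ⟨
    product (factor ∘ element) * product (unit ∘ element)  ≈⟨ ∑-distrib-+ (factor ∘ element) (unit ∘ element) ⟨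
    product (λ i → factor (element i) * unit (element i))   ≈⟨ sum-cong-≋ (λ i → unit-* (element i)) ⟨
    product (λ i → unit (x * element i))
      ≈⟨ sum-bijection *-commutativeMonoid unit-cong (x *_) (x′ *_) *-congˡ *-congˡ
           (cancel xx′≈1) (cancel (trans (*-comm x′ x) xx′≈1)) ⟨
    product (unit ∘ element)                            ∎)
    where
    open MonoidSum *-commutativeMonoid using (sum-cong-≋; ∑-distrib-+; sum-replicate) renaming (sum to product)
    open SetoidReasoning setoid

    cancel : ∀ {y z} → y * z ≈ 1# → ∀ w → y * (z * w) ≈ w
    cancel yz≈1 w = trans (sym (*-assoc _ _ w)) (trans (*-congʳ yz≈1) (*-identityˡ w))

    unit factor : Carrier → Carrier
    unit y with y ≟ 0#
    ... | yes _ = 1#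
    ... | no _  = y
    factor y with y ≟ 0#
    ... | yes _ = 1#
    ... | no _  = x

    unit-≉0 : ∀ y → ¬ unit y ≈ 0#
    unit-≉0 y with y ≟ 0#
    ... | yes _  = 1≉0
    ... | no y≉0 = y≉0

    unit-cong : ∀ {y z} → y ≈ z → unit y ≈ unit z
    unit-cong {y} {z} y≈z with y ≟ 0# | z ≟ 0#
    ... | yes _   | yes _   = refl
    ... | yes y≈0 | no z≉0  = ⊥-elim (z≉0 (trans (sym y≈z) y≈0))
    ... | no y≉0  | yes z≈0 = ⊥-elim (y≉0 (trans y≈z z≈0))
    ... | no _    | no _    = y≈z

    unit-* : ∀ y → unit (x * y) ≈ factor y * unit y
    unit-* y with y ≟ 0# | x * y ≟ 0#
    ... | yes _   | yes _    = sym (*-identityˡ 1#)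
    ... | yes y≈0 | no xy≉0  = ⊥-elim (xy≉0 (trans (*-congˡ y≈0) (zeroʳ x)))
    ... | no y≉0  | yes xy≈0 = ⊥-elim (*-≉0 x≉0 y≉0 xy≈0)
    ... | no _    | no _     = refl

    factor-0 : factor (element (index 0#)) ≈ 1#
    factor-0 with element (index 0#) ≟ 0#
    ... | yes _  = refl
    ... | no 0≉0 = ⊥-elim (0≉0 (sym (element-index 0#)))

    factor-≉0 : ∀ i → i ≢ index 0# → factor (element i) ≈ x
    factor-≉0 i i≢0 with element i ≟ 0#
    ... | yes i≈0 = ⊥-elim (i≢0 (≡.trans (≡.sym (index-element i)) (index-cong i≈0)))
    ... | no _    = refl

    x^[q-1] : product (factor ∘ element) ≈ x ^ suc m
    x^[q-1] = trans (sum-except-one *-commutativeMonoid (factor ∘ element) (index 0#) factor-≉0)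
                    (trans (*-cong factor-0 (sum-replicate (suc m))) (*-identityˡ _))

    product-≉0 : ∀ {n} (t : Fin n → Carrier) → (∀ i → ¬ t i ≈ 0#) → ¬ product t ≈ 0#
    product-≉0 {zero}  t t≉0 = 1≉0
    product-≉0 {suc n} t t≉0 = *-≉0 (t≉0 zero) (product-≉0 (t ∘ suc) (t≉0 ∘ suc))

  x^q≈x : ∀ x → x ^ q ≈ x
  x^q≈x x with x ≟ 0#
  ... | yes x≈0 = trans (*-congʳ x≈0) (trans (zeroˡ _) (sym x≈0))
  ... | no x≉0  = trans (*-congˡ (x^[q-1]≈1 x≉0)) (*-identityʳ x)

  module _ (n : ℕ) (n·1≈0 : n · 1# ≈ 0#) where
    open MonoidSum ℕ.+-0-commutativeMonoid using (sum; sum-cong-≗; ∑-comm; sum-init-last)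
    open ≡.≡-Reasoning

    private
      n·x≈0 : ∀ x → n · x ≈ 0#
      n·x≈0 x = trans (×-congʳ n (sym (*-identityˡ x)))
        (trans (sym (×-assoc-* n 1# x)) (trans (*-congʳ n·1≈0) (zeroˡ x)))

      sum-replicate≡* : ∀ k t → sum (replicate k t) ≡ k ℕ.* t
      sum-replicate≡* zero    t = ≡.refl
      sum-replicate≡* (suc k) t = ≡.cong (t ℕ.+_) (sum-replicate≡* k t)

      total : (Carrier → ℕ) → ℕ
      total g = sum (g ∘ element)

      Respects : (Carrier → ℕ) → Set _
      Respects g = ∀ {x y} → x ≈ y → g x ≡ g y

      InvariantUnder : (Carrier → ℕ) → Carrier → Set _
      InvariantUnder g x = ∀ a → g (a + x) ≡ g a

      -- Convolution with the multiset 0, x, ..., (n-1)x. The mass is multiplied by n, and as n·x =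
      -- 0 the result is invariant under x. Weights are natural numbers so that the final total is a
      -- divisibility of integers.
      spread : Carrier → (Carrier → ℕ) → Carrier → ℕ
      spread x g a = sum {n} λ i → g (a + toℕ i · x)

      spread-total : ∀ x g → Respects g → total (spread x g) ≡ n ℕ.* total g
      spread-total x g g-cong = begin
        total (spread x g)
          ≡⟨ ∑-comm (λ i (j : Fin n) → g (element i + toℕ j · x)) ⟩
        (sum {n} λ j → sum λ i → g (element i + toℕ j · x))
          ≡⟨ sum-cong-≗ {n} (λ j → sum-translation ℕ.+-0-commutativeMonoid g-cong (toℕ j · x)) ⟨
        sum (replicate n (total g))
          ≡⟨ sum-replicate≡* n (total g) ⟩
        n ℕ.* total g ∎

      -- The sum of the k+1 values s 0, ..., s k can be split off at either end; the two split-off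
      -- terms agree and cancel.
      sum-shift : ∀ (s : ℕ → ℕ) k → s k ≡ s 0 → sum {k} (s ∘ suc ∘ toℕ) ≡ sum {k} (s ∘ toℕ)
      sum-shift s k sk≡s0 = ℕ.+-cancelˡ-≡ (s 0) _ _ (begin
        s 0 ℕ.+ sum {k} (s ∘ suc ∘ toℕ)
          ≡⟨ sum-init-last {k} (s ∘ toℕ) ⟩
        sum {k} (s ∘ toℕ ∘ inject₁) ℕ.+ s (toℕ (fromℕ k))
          ≡⟨ ≡.cong₂ ℕ._+_ (sum-cong-≗ {k} (λ i → ≡.cong s (toℕ-inject₁ i)))
                           (≡.trans (≡.cong s (toℕ-fromℕ k)) sk≡s0) ⟩
        sum {k} (s ∘ toℕ) ℕ.+ s 0
          ≡⟨ ℕ.+-comm _ (s 0) ⟩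
        s 0 ℕ.+ sum {k} (s ∘ toℕ) ∎)

      spread-invariant : ∀ x g → Respects g → InvariantUnder (spread x g) x
      spread-invariant x g g-cong a = ≡.trans
        (sum-cong-≗ {n} (λ i → g-cong (+-assoc a x (toℕ i · x))))
        (sum-shift (λ k → g (a + k · x)) n (g-cong (+-congˡ (n·x≈0 x))))

      spread-preserves : ∀ x g y → Respects g → InvariantUnder g y → InvariantUnder (spread x g) y
      spread-preserves x g y g-cong inv a = sum-cong-≗ {n} λ i → ≡.trans
        (g-cong (trans (+-assoc a y _) (trans (+-congˡ (+-comm y _)) (sym (+-assoc a _ y)))))
        (inv (a + toℕ i · x))

      δ : Carrier → ℕ
      δ a with a ≟ 0#
      ... | yes _ = 1
      ... | no _  = 0

      δ-cong : Respects δ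
      δ-cong {y} {z} y≈z with y ≟ 0# | z ≟ 0#
      ... | yes _   | yes _   = ≡.refl
      ... | yes y≈0 | no z≉0  = ⊥-elim (z≉0 (trans (sym y≈z) y≈0))
      ... | no y≉0  | yes z≈0 = ⊥-elim (y≉0 (trans y≈z z≈0))
      ... | no _    | no _    = ≡.refl

      δ-total : total δ ≡ 1
      δ-total = begin
        total δ
          ≡⟨ sum-except-one ℕ.+-0-commutativeMonoid (δ ∘ element) (index 0#) δ-≉0 ⟩
        δ (element (index 0#)) ℕ.+ sum (replicate (suc m) 0)
          ≡⟨ ≡.cong₂ ℕ._+_ δ-0 (≡.trans (sum-replicate≡* (suc m) 0) (ℕ.*-zeroʳ (suc m))) ⟩
        1 ∎
        where
        δ-0 : δ (element (index 0#)) ≡ 1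
        δ-0 with element (index 0#) ≟ 0#
        ... | yes _  = ≡.refl
        ... | no 0≉0 = ⊥-elim (0≉0 (sym (element-index 0#)))
        δ-≉0 : ∀ i → i ≢ index 0# → δ (element i) ≡ 0
        δ-≉0 i i≢0 with element i ≟ 0#
        ... | yes i≈0 = ⊥-elim (i≢0 (≡.trans (≡.sym (index-element i)) (index-cong i≈0)))
        ... | no _    = ≡.refl

      invariant-weight : ∀ {k} (xs : Fin k → Carrier) →
        ∃ λ g → Respects g × total g ≡ n ℕ.^ k × (∀ i → InvariantUnder g (xs i))
      invariant-weight {zero}  xs = δ , δ-cong , δ-total , λ ()
      invariant-weight {suc k} xs with invariant-weight (xs ∘ suc)
      ... | g , g-cong , g-total , g-inv = spread (xs zero) g
        , (λ a≈b → sum-cong-≗ {n} λ i → g-cong (+-congʳ a≈b))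
        , ≡.trans (spread-total (xs zero) g g-cong) (≡.cong (n ℕ.*_) g-total)
        , λ { zero    → spread-invariant (xs zero) g g-cong
            ; (suc i) → spread-preserves (xs zero) g (xs (suc i)) g-cong (g-inv i) }

    -- Spreading a unit mass along every element, n steps at a time, gives a translation-invariant
    -- weight on the field with total n^q.
    q∣n^q : ∃ λ k → n ℕ.^ q ≡ q ℕ.* k
    q∣n^q = g 0# , (begin
      n ℕ.^ q                   ≡⟨ g-total ⟨
      total g                   ≡⟨ sum-cong-≗ {q} constant ⟩
      sum (replicate q (g 0#))  ≡⟨ sum-replicate≡* q (g 0#) ⟩
      q ℕ.* g 0#                ∎)
      where
      weight : ∃ λ g → Respects g × total g ≡ n ℕ.^ q × (∀ i → InvariantUnder g (element i))
      weight = invariant-weight element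

      g : Carrier → ℕ
      g = proj₁ weight

      g-total : total g ≡ n ℕ.^ q
      g-total = proj₁ (proj₂ (proj₂ weight))

      constant : ∀ i → g (element i) ≡ g 0#
      constant i = ≡.trans (proj₁ (proj₂ weight) (sym (+-identityˡ _))) (proj₂ (proj₂ (proj₂ weight)) i 0#)

-- Polynomials as coefficient tuples

-- Single Horner steps of the evaluation laws below. Subtraction is avoided, a difference being a
-- variable `d`, so that the semiring solver applies.
module SemiringIdentities {c ℓ} (R : CommutativeSemiring c ℓ) where
  open CommutativeSemiring R
  open NaturalCoefficients R

  taylor-step : ∀ a r d p e → a + (r + d) * (p + d * e) ≈ (a + r * p) + d * (p + (r + d) * e)
  taylor-step = solve 5 (λ a r d p e →
    a :+ (r :+ d) :* (p :+ d :* e) := (a :+ r :* p) :+ d :* (p :+ (r :+ d) :* e)) refl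

  horner-+ : ∀ a b z s t → (a + b) + z * (s + t) ≈ (a + z * s) + (b + z * t)
  horner-+ = solve 5 (λ a b z s t → (a :+ b) :+ z :* (s :+ t) := (a :+ z :* s) :+ (b :+ z :* t)) refl

  horner-* : ∀ a b z s → a * b + z * (a * s) ≈ a * (b + z * s)
  horner-* = solve 4 (λ a b z s → a :* b :+ z :* (a :* s) := a :* (b :+ z :* s)) refl

  horner-product : ∀ a z s t → a * t + z * (s * t) ≈ (a + z * s) * t
  horner-product = solve 4 (λ a z s t → a :* t :+ z :* (s :* t) := (a :+ z :* s) :* t) refl

  horner-last : ∀ a z s b w → a + z * (s + b * w) ≈ (a + z * s) + b * (z * w)
  horner-last = solve 5 (λ a z s b w → a :+ z :* (s :+ b :* w) := (a :+ z :* s) :+ b :* (z :* w)) refl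

  horner-wrap : ∀ a b z s → 0# + z * ((a + b) + z * s) ≈ z * (a + z * s) + b * z
  horner-wrap = solve 4 (λ a b z s → con 0 :+ z :* ((a :+ b) :+ z :* s) := z :* (a :+ z :* s) :+ b :* z) refl

  horner-unwrap : ∀ z s b w → z * s + b * (z * w) ≈ z * (s + b * w)
  horner-unwrap = solve 4 (λ z s b w → z :* s :+ b :* (z :* w) := z :* (s :+ b :* w)) refl

module Polynomial {c ℓ} (R : CommutativeRing c ℓ) where
  open CommutativeRing R hiding (zero)
  open SemiringExp semiring using (_^_)
  open SemiringIdentities commutativeSemiring
  open SetoidReasoning setoid

  eval : ∀ {n} → (Fin n → Carrier) → Carrier → Carrier
  eval {zero}  a z = 0#
  eval {suc n} a z = a zero + z * eval (a ∘ suc) z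

  eval-cong : ∀ {n} (a : Fin n → Carrier) {y z} → y ≈ z → eval a y ≈ eval a z
  eval-cong {zero}  a y≈z = refl
  eval-cong {suc n} a y≈z = +-congˡ (*-cong y≈z (eval-cong (a ∘ suc) y≈z))

  eval-zero : ∀ {n} {a : Fin n → Carrier} → (∀ i → a i ≈ 0#) → ∀ z → eval a z ≈ 0#
  eval-zero {zero}  a≈0 z = refl
  eval-zero {suc n} a≈0 z =
    trans (+-cong (a≈0 zero) (trans (*-congˡ (eval-zero (a≈0 ∘ suc) z)) (zeroʳ z))) (+-identityˡ 0#)

  eval-+ : ∀ {n} (a b : Fin n → Carrier) z → eval (λ i → a i + b i) z ≈ eval a z + eval b z
  eval-+ {zero}  a b z = sym (+-identityˡ 0#)
  eval-+ {suc n} a b z = trans (+-congˡ (*-congˡ (eval-+ (a ∘ suc) (b ∘ suc) z))) (horner-+ _ _ z _ _)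

  eval-scale : ∀ {n} x (a : Fin n → Carrier) z → eval (λ i → x * a i) z ≈ x * eval a z
  eval-scale {zero}  x a z = sym (zeroʳ x)
  eval-scale {suc n} x a z = trans (+-congˡ (*-congˡ (eval-scale x (a ∘ suc) z))) (horner-* x _ z _)

  eval-last : ∀ {n} (a : Fin (suc n) → Carrier) z →
    eval a z ≈ eval (a ∘ inject₁) z + a (fromℕ n) * z ^ n
  eval-last {zero}  a z = begin
    a zero + z * 0#      ≈⟨ +-congˡ (zeroʳ z) ⟩
    a zero + 0#          ≈⟨ +-comm _ 0# ⟩
    0# + a zero          ≈⟨ +-congˡ (*-identityʳ _) ⟨
    0# + a zero * 1#     ∎
  eval-last {suc n} a z = trans (+-congˡ (*-congˡ (eval-last (a ∘ suc) z))) (horner-last _ z _ _ _)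

  constant : ∀ {n} → Carrier → Fin (suc n) → Carrier
  constant x zero    = x
  constant x (suc _) = 0#

  eval-constant : ∀ {n} x z → eval (constant {n} x) z ≈ x
  eval-constant {n} x z =
    trans (+-congˡ (trans (*-congˡ (eval-zero {n} (λ _ → refl) z)) (zeroʳ z))) (+-identityʳ x)

  -- Multiplication by X modulo X^(2+n) - X.
  cycle : ∀ {n} → (Fin (2 ℕ.+ n) → Carrier) → Fin (2 ℕ.+ n) → Carrier
  cycle {n} a zero          = 0#
  cycle {n} a (suc zero)    = a zero + a (fromℕ (suc n))
  cycle {n} a (suc (suc i)) = a (inject₁ (suc i))

  -- Multiplying by z sends the top term to b z^(2+n), which equals b z; this is the extra summand
  -- in coefficient 1 of `cycle`.
  eval-cycle : ∀ {n} (a : Fin (2 ℕ.+ n) → Carrier) {z} → z ^ (2 ℕ.+ n) ≈ z →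
    eval (cycle a) z ≈ z * eval a z
  eval-cycle {n} a {z} z^q≈z = begin
    eval (cycle a) z                            ≈⟨ horner-wrap _ _ z _ ⟩
    z * eval (a ∘ inject₁) z + b * z            ≈⟨ +-congˡ (*-congˡ z^q≈z) ⟨
    z * eval (a ∘ inject₁) z + b * z ^ (2 ℕ.+ n) ≈⟨ horner-unwrap z _ b _ ⟩
    z * (eval (a ∘ inject₁) z + b * z ^ suc n)  ≈⟨ *-congˡ (eval-last a z) ⟨
    z * eval a z                                ∎
    where
    b : Carrier
    b = a (fromℕ (suc n))

  -- Synthetic division by X - r: the coefficients are the values at r of the successive tails of
  -- `a`, and the remainder is the value of `a` itself.
  quotient : ∀ {n} → (Fin (suc n) → Carrier) → Carrier → Fin n → Carrier
  quotient {suc n} a r zero    = eval (a ∘ suc) r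
  quotient {suc n} a r (suc i) = quotient (a ∘ suc) r i

  eval-quotient : ∀ {n} (a : Fin (suc n) → Carrier) r d →
    eval a (r + d) ≈ eval a r + d * eval (quotient a r) (r + d)
  eval-quotient {zero}  a r d = begin
    a zero + (r + d) * 0#         ≈⟨ +-congˡ (zeroʳ _) ⟩
    a zero + 0#                   ≈⟨ +-congˡ (zeroʳ r) ⟨
    a zero + r * 0#               ≈⟨ +-identityʳ _ ⟨
    a zero + r * 0# + 0#          ≈⟨ +-congˡ (zeroʳ d) ⟨
    a zero + r * 0# + d * 0#      ∎
  eval-quotient {suc n} a r d =
    trans (+-congˡ (*-congˡ (eval-quotient (a ∘ suc) r d))) (taylor-step _ r d _ _)

  -- Quotient and remainder determine a polynomial. The recursion works because the tail of `a` has
  -- remainder `quotient a r zero` and quotient `quotient a r ∘ suc`.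
  quotient-zero : ∀ {n} (a : Fin (suc n) → Carrier) r → eval a r ≈ 0# →
    (∀ i → quotient a r i ≈ 0#) → ∀ i → a i ≈ 0#
  quotient-zero {n} a r ar≈0 quotient≈0 zero = begin
    a zero                          ≈⟨ +-identityʳ _ ⟨
    a zero + 0#                     ≈⟨ +-congˡ (zeroʳ r) ⟨
    a zero + r * 0#                 ≈⟨ +-congˡ (*-congˡ (tail≈0 n a quotient≈0)) ⟨
    a zero + r * eval (a ∘ suc) r   ≈⟨ ar≈0 ⟩
    0#                              ∎
    where
    tail≈0 : ∀ n (a : Fin (suc n) → Carrier) → (∀ i → quotient a r i ≈ 0#) → eval (a ∘ suc) r ≈ 0#
    tail≈0 zero    a _          = refl
    tail≈0 (suc n) a quotient≈0 = quotient≈0 zero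
  quotient-zero {suc n} a r ar≈0 quotient≈0 (suc i) =
    quotient-zero (a ∘ suc) r (quotient≈0 zero) (quotient≈0 ∘ suc) i

module _ {c ℓ} (F : Field c ℓ) where
  open Field F hiding (zero)
  open FieldProperties F using (zero-product)
  open Polynomial commutativeRing
  open GroupProperties +-group using (x∙y⁻¹≈ε⇒x≈y; //-rightDividesˡ)
  open SetoidReasoning setoid

  -- Dividing by X - r for the first point r lowers the length by one. The other points stay roots
  -- of the quotient, as their differences from r are nonzero and can be cancelled.
  vanishing⇒zero : ∀ {n} (a : Fin n → Carrier) (points : Fin n → Carrier) →
    (∀ i j → points i ≈ points j → i ≡ j) → (∀ i → eval a (points i) ≈ 0#) → ∀ i → a i ≈ 0#
  vanishing⇒zero {suc n} a points injective roots =
    quotient-zero a r (roots zero)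
      (vanishing⇒zero (quotient a r) (points ∘ suc)
        (λ i j → suc-injective ∘ injective (suc i) (suc j)) quotient-roots)
    where
    r : Carrier
    r = points zero

    quotient-roots : ∀ i → eval (quotient a r) (points (suc i)) ≈ 0#
    quotient-roots i = zero-product d≉0 (begin
      d * eval (quotient a r) x           ≈⟨ *-congˡ (eval-cong (quotient a r) r+d≈x) ⟨
      d * eval (quotient a r) (r + d)     ≈⟨ +-identityˡ _ ⟨
      0# + d * eval (quotient a r) (r + d) ≈⟨ +-congʳ (roots zero) ⟨
      eval a r + d * eval (quotient a r) (r + d) ≈⟨ eval-quotient a r d ⟨
      eval a (r + d)                      ≈⟨ eval-cong a r+d≈x ⟩
      eval a x                            ≈⟨ roots (suc i) ⟩
      0#                                  ∎)
      where
      x d : Carrier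
      x = points (suc i)
      d = x - r

      r+d≈x : r + d ≈ x
      r+d≈x = trans (+-comm r d) (//-rightDividesˡ r x)

      d≉0 : ¬ d ≈ 0#
      d≉0 d≈0 with () ← injective (suc i) zero (x∙y⁻¹≈ε⇒x≈y x r d≈0)

-- Isomorphism of finite fields of equal size

module _ {c₁ ℓ₁ c₂ ℓ₂} (F : Field c₁ ℓ₁) (L : Field c₂ ℓ₂) where
  private
    module F = Field F
    module L = Field L

  record FieldIso : Set (c₁ ⊔ ℓ₁ ⊔ c₂ ⊔ ℓ₂) where
    field
      to        : F.Carrier → L.Carrier
      to-cong   : ∀ {x y} → x F.≈ y → to x L.≈ to y
      to-+      : ∀ x y → to (x F.+ y) L.≈ to x L.+ to y
      to-*      : ∀ x y → to (x F.* y) L.≈ to x L.* to y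
      to-0      : to F.0# L.≈ L.0#
      injective : ∀ {x y} → to x L.≈ to y → x F.≈ y
      from      : L.Carrier → F.Carrier
      to-from   : ∀ y → to (from y) L.≈ y

-- Pigeonhole: punching out a missed value would inject `Fin (suc n)` into `Fin n`.
injective⇒surjective : ∀ {n} (f : Fin n → Fin n) → InjectiveF f → ∀ j → ∃ λ i → f i ≡ j
injective⇒surjective {suc n} f f-injective j with any? (λ i → f i Fin.≟ j)
... | yes found  = found
... | no missing = ⊥-elim (ℕ.1+n≰n (injective⇒≤ {f = λ i → punchOut (j≢f i)}
        (λ {i} {i′} eq → f-injective i i′ (punchOut-injective (j≢f i) (j≢f i′) eq))))
  where
  j≢f : ∀ i → j ≢ f i
  j≢f i j≡fi = missing (i , ≡.sym j≡fi)

module _ {c ℓ} (F : Field c ℓ) (m : ℕ) (card : Projective.HasCard F (2 ℕ.+ m)) where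
  open Field F hiding (zero)
  open FieldProperties F
  open FiniteField F m card
  open SemiringMult semiring using (×1-homo-*; ×-homo-1) renaming (_×_ to _·_)
  open SemiringExp semiring using (_^_)
  open RingProperties ring using (-1*x≈-x)
  open SetoidReasoning setoid

  ×1-homo-^ : ∀ n k → (n ℕ.^ k) · 1# ≈ (n · 1#) ^ k
  ×1-homo-^ n zero    = ×-homo-1 1#
  ×1-homo-^ n (suc k) = trans (×1-homo-* n (n ℕ.^ k)) (*-congˡ (×1-homo-^ n k))

  q∣n^q⇒n·1≈0 : ∀ n k → n ℕ.^ q ≡ q ℕ.* k → n · 1# ≈ 0#
  q∣n^q⇒n·1≈0 n k n^q≡qk = decidable-stable (n · 1# ≟ 0#) λ n·1≉0 → ^-≉0 q n·1≉0 (begin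
    (n · 1#) ^ q          ≈⟨ ×1-homo-^ n q ⟨
    (n ℕ.^ q) · 1#        ≡⟨ ≡.cong (_· 1#) n^q≡qk ⟩
    (q ℕ.* k) · 1#        ≈⟨ ×1-homo-* q k ⟩
    q · 1# * k · 1#       ≈⟨ *-congʳ q·1≈0 ⟩
    0# * k · 1#           ≈⟨ zeroˡ _ ⟩
    0#                    ∎)

  -- The indicator of 0 given by Fermat's x^(q-1) = 1. The difference is spelled with a factor
  -- `- 1#` so that closure under sums, products and `-1∈` keeps it inside a graph.
  isZero : Carrier → Carrier
  isZero x = 1# + - 1# * x ^ suc m

  isZero-yes : ∀ {x} → x ≈ 0# → isZero x ≈ 1#
  isZero-yes {x} x≈0 = begin
    1# + - 1# * (x * x ^ m)  ≈⟨ +-congˡ (*-congˡ (trans (*-congʳ x≈0) (zeroˡ _))) ⟩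
    1# + - 1# * 0#           ≈⟨ +-congˡ (zeroʳ _) ⟩
    1# + 0#                  ≈⟨ +-identityʳ 1# ⟩
    1#                       ∎

  isZero-no : ∀ {x} → ¬ x ≈ 0# → isZero x ≈ 0#
  isZero-no {x} x≉0 = begin
    1# + - 1# * x ^ suc m    ≈⟨ +-congˡ (-1*x≈-x _) ⟩
    1# + - (x ^ suc m)       ≈⟨ +-congˡ (-‿cong (x^[q-1]≈1 x≉0)) ⟩
    1# + - 1#                ≈⟨ -‿inverseʳ 1# ⟩
    0#                       ∎

  -- The multiplier depends on q alone, so the same natural number represents -1 in both fields;
  -- `Prime`, built from natural multiples, therefore contains (-1, -1).
  -1≈[q-1]·1 : - 1# ≈ suc m · 1#
  -1≈[q-1]·1 = sym (inverseʳ-unique 1# (suc m · 1#) q·1≈0)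
    where open GroupProperties +-group using (inverseʳ-unique)

module Isomorphism {c₁ ℓ₁ c₂ ℓ₂} (F : Field c₁ ℓ₁) (L : Field c₂ ℓ₂) (m : ℕ)
  (cardF : Projective.HasCard F (2 ℕ.+ m)) (cardL : Projective.HasCard L (2 ℕ.+ m)) where

  private
    module F where
      open Field F public
      open FieldProperties F public
      open FiniteField F m cardF public
      open SemiringMult semiring public renaming (_×_ to _·_)
      open SemiringExp semiring public using (_^_)
      open Polynomial commutativeRing public using (eval; eval-cong; eval-zero)
    module L where
      open Field L public
      open FieldProperties L public
      open FiniteField L m cardL public
      open SemiringMult semiring public renaming (_×_ to _·_)
      open SemiringExp semiring public using (_^_)
      open Polynomial commutativeRing public using (eval; eval-cong)
    q : ℕ
    q = 2 ℕ.+ m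
    g : Level
    g = c₁ ⊔ ℓ₁ ⊔ c₂ ⊔ ℓ₂

  -- A coefficient tuple of pairs from G is a polynomial over the subring together with its image
  -- over L, and one evaluation in the product computes both.
  R : CommutativeRing (c₁ ⊔ c₂) (ℓ₁ ⊔ ℓ₂)
  R = DirectProduct.commutativeRing F.commutativeRing L.commutativeRing

  open CommutativeRing R hiding (zero)
  open SemiringExp semiring using (_^_)
  open SemiringMult semiring using (×-homo-+; ×1-homo-*; ×-homo-1) renaming (_×_ to _·_)
  open Polynomial R

  ^-proj₁ : ∀ z n → proj₁ (z ^ n) ≡ proj₁ z F.^ n
  ^-proj₁ z zero    = ≡.refl
  ^-proj₁ z (suc n) = ≡.cong (proj₁ z F.*_) (^-proj₁ z n)

  ^-proj₂ : ∀ z n → proj₂ (z ^ n) ≡ proj₂ z L.^ n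
  ^-proj₂ z zero    = ≡.refl
  ^-proj₂ z (suc n) = ≡.cong (proj₂ z L.*_) (^-proj₂ z n)

  ×-proj₁ : ∀ n → proj₁ (n · 1#) ≡ n F.· F.1#
  ×-proj₁ zero    = ≡.refl
  ×-proj₁ (suc n) = ≡.cong (F.1# F.+_) (×-proj₁ n)

  ×-proj₂ : ∀ n → proj₂ (n · 1#) ≡ n L.· L.1#
  ×-proj₂ zero    = ≡.refl
  ×-proj₂ (suc n) = ≡.cong (L.1# L.+_) (×-proj₂ n)

  eval-proj₁ : ∀ {n} (a : Fin n → Carrier) z → proj₁ (eval a z) ≡ F.eval (proj₁ ∘ a) (proj₁ z)
  eval-proj₁ {zero}  a z = ≡.refl
  eval-proj₁ {suc n} a z = ≡.cong (λ t → proj₁ (a zero) F.+ proj₁ z F.* t) (eval-proj₁ (a ∘ suc) z)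

  eval-proj₂ : ∀ {n} (a : Fin n → Carrier) z → proj₂ (eval a z) ≡ L.eval (proj₂ ∘ a) (proj₂ z)
  eval-proj₂ {zero}  a z = ≡.refl
  eval-proj₂ {suc n} a z = ≡.cong (λ t → proj₂ (a zero) L.+ proj₂ z L.* t) (eval-proj₂ (a ∘ suc) z)

  z^q≈z : ∀ z → z ^ q ≈ z
  z^q≈z z = F.trans (F.reflexive (^-proj₁ z q)) (F.x^q≈x (proj₁ z))
          , L.trans (L.reflexive (^-proj₂ z q)) (L.x^q≈x (proj₂ z))

  zeroIndicator : Carrier → Carrier
  zeroIndicator z = 1# + - 1# * z ^ suc m

  zeroIndicator-proj₁ : ∀ z → proj₁ (zeroIndicator z) ≡ isZero F m cardF (proj₁ z)
  zeroIndicator-proj₁ z = ≡.cong (λ t → F.1# F.+ F.- F.1# F.* t) (^-proj₁ z (suc m))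

  zeroIndicator-proj₂ : ∀ z → proj₂ (zeroIndicator z) ≡ isZero L m cardL (proj₂ z)
  zeroIndicator-proj₂ z = ≡.cong (λ t → L.1# L.+ L.- L.1# L.* t) (^-proj₂ z (suc m))

  -- 0↦0 makes the subring G of F × L the graph of a homomorphism from a subring of F to L.
  record HomGraph (G : Carrier → Set g) : Set g where
    field
      1∈     : G 1#
      -1∈    : G (- 1#)
      0∈     : G 0#
      +∈     : ∀ {x y} → G x → G y → G (x + y)
      *∈     : ∀ {x y} → G x → G y → G (x * y)
      0↦0    : ∀ {z} → G z → proj₁ z F.≈ F.0# → proj₂ z L.≈ L.0#

    ^∈ : ∀ {x} → G x → ∀ n → G (x ^ n)
    ^∈ x∈ zero    = 1∈
    ^∈ x∈ (suc n) = *∈ x∈ (^∈ x∈ n)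

    zeroIndicator∈ : ∀ {x} → G x → G (zeroIndicator x)
    zeroIndicator∈ x∈ = +∈ 1∈ (*∈ -1∈ (^∈ x∈ (suc m)))

    -- If z had first component nonzero and second component 0, then 1 - z^(q-1) would be (0, 1),
    -- against `0↦0`.
    0↤0 : ∀ {z} → G z → proj₂ z L.≈ L.0# → proj₁ z F.≈ F.0#
    0↤0 {z} z∈ z₂≈0 = decidable-stable (proj₁ z F.≟ F.0#) λ z₁≉0 → L.1≉0 (L.trans
      (L.sym (L.trans (L.reflexive (zeroIndicator-proj₂ z)) (isZero-yes L m cardL z₂≈0)))
      (0↦0 (zeroIndicator∈ z∈)
        (F.trans (F.reflexive (zeroIndicator-proj₁ z)) (isZero-no F m cardF z₁≉0))))

    functional : ∀ {x y} → G x → G y → proj₁ x F.≈ proj₁ y → proj₂ x L.≈ proj₂ y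
    functional {x} {y} x∈ y∈ x₁≈y₁ = LP.x∙y⁻¹≈ε⇒x≈y _ _ (L.trans (L.+-congˡ (L.sym (LR.-1*x≈-x _)))
      (0↦0 (+∈ x∈ (*∈ -1∈ y∈)) (F.trans (F.+-congˡ (FR.-1*x≈-x _)) (FP.x≈y⇒x∙y⁻¹≈ε x₁≈y₁))))
      where
      module FP = GroupProperties F.+-group
      module LP = GroupProperties L.+-group
      module FR = RingProperties F.ring
      module LR = RingProperties L.ring

  module Extension {G : Carrier → Set g} (graph : HomGraph G) where
    open HomGraph graph

    -- As z^q = z on F × L, polynomials need only degree less than q.
    PolyFun : (Carrier → Carrier) → Set g
    PolyFun f = ∃ λ (a : Fin q → Carrier) → (∀ i → G (a i)) × (∀ z → f z ≈ eval a z)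

    eval-PolyFun : ∀ {a : Fin q → Carrier} → (∀ i → G (a i)) → PolyFun (eval a)
    eval-PolyFun {a} a∈ = a , a∈ , λ _ → refl

    constant∈ : ∀ {x n} → G x → ∀ i → G (constant {n} x i)
    constant∈ x∈ zero    = x∈
    constant∈ x∈ (suc _) = 0∈

    const-PolyFun : ∀ {x} → G x → PolyFun (λ _ → x)
    const-PolyFun {x} x∈ = constant x , constant∈ x∈ , λ z → sym (eval-constant {suc m} x z)

    +-PolyFun : ∀ {f h} → PolyFun f → PolyFun h → PolyFun (λ z → f z + h z)
    +-PolyFun (a , a∈ , f≈) (b , b∈ , h≈) = (λ i → a i + b i) , (λ i → +∈ (a∈ i) (b∈ i)) ,
      λ z → trans (+-cong (f≈ z) (h≈ z)) (sym (eval-+ a b z))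

    scale-PolyFun : ∀ {x f} → G x → PolyFun f → PolyFun (λ z → x * f z)
    scale-PolyFun {x} x∈ (a , a∈ , f≈) = (λ i → x * a i) , (λ i → *∈ x∈ (a∈ i)) ,
      λ z → trans (*-congˡ (f≈ z)) (sym (eval-scale x a z))

    variable-PolyFun : ∀ {f} → PolyFun f → PolyFun (λ z → z * f z)
    variable-PolyFun (a , a∈ , f≈) = cycle a , cycle∈ ,
      λ z → trans (*-congˡ (f≈ z)) (sym (eval-cycle a (z^q≈z z)))
      where
      cycle∈ : ∀ i → G (cycle a i)
      cycle∈ zero          = 0∈
      cycle∈ (suc zero)    = +∈ (a∈ zero) (a∈ _)
      cycle∈ (suc (suc i)) = a∈ _

    PolyFun-cong : ∀ {f h} → (∀ z → f z ≈ h z) → PolyFun h → PolyFun f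
    PolyFun-cong f≈h (a , a∈ , h≈) = a , a∈ , λ z → trans (f≈h z) (h≈ z)

    -- By recursion on the first factor, (a + z s) h = a h + z (s h). Each multiplication by z is
    -- reduced at once by `cycle`, so the length stays q.
    *-PolyFun : ∀ {f h} → PolyFun f → PolyFun h → PolyFun (λ z → f z * h z)
    *-PolyFun {h = h} (a , a∈ , f≈) H = PolyFun-cong (λ z → *-congʳ (f≈ z)) (eval-* a a∈)
      where
      eval-* : ∀ {n} (a : Fin n → Carrier) → (∀ i → G (a i)) → PolyFun (λ z → eval a z * h z)
      eval-* {zero}  a a∈ = PolyFun-cong (λ z → zeroˡ _) (const-PolyFun 0∈)
      eval-* {suc n} a a∈ = PolyFun-cong (λ z → sym (SemiringIdentities.horner-product commutativeSemiring _ z _ _))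
        (+-PolyFun (scale-PolyFun (a∈ zero) H) (variable-PolyFun (eval-* (a ∘ suc) (a∈ ∘ suc))))

    ^-PolyFun : ∀ {f} → PolyFun f → ∀ n → PolyFun (λ z → f z ^ n)
    ^-PolyFun f-poly zero    = const-PolyFun 1∈
    ^-PolyFun f-poly (suc n) = *-PolyFun f-poly (^-PolyFun f-poly n)

    zeroIndicator-PolyFun : ∀ {f} → PolyFun f → PolyFun (zeroIndicator ∘ f)
    zeroIndicator-PolyFun f-poly =
      +-PolyFun (const-PolyFun 1∈) (scale-PolyFun -1∈ (^-PolyFun f-poly (suc m)))

    module _ (x : F.Carrier) where

      -- Every polynomial relation of x over the subring holds for y after applying the
      -- homomorphism. This is exactly `0↦0` for the ring generated by G and (x , y).
      Conjugate : L.Carrier → Set g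
      Conjugate y = ∀ (a : Fin q → Carrier) → (∀ i → G (a i)) →
        proj₁ (eval a (x , y)) F.≈ F.0# → proj₂ (eval a (x , y)) L.≈ L.0#

      -- Each condition fixes one component of z and leaves the other free, as the components of a
      -- polynomial function do not interact. One V thus serves all the `ys` together.
      Separating : ∀ {n} → (Fin n → L.Carrier) → (Carrier → Carrier) → Set g
      Separating ys V = PolyFun V
        × (∀ z → proj₁ z F.≈ x → proj₁ (V z) F.≈ F.1#)
        × (∀ i z → proj₂ z L.≈ ys i → proj₂ (V z) L.≈ L.0#)

      -- Refuting a universal statement gives no witness, so the goal is doubly negated. Inside the
      -- attempt to prove `Conjugate (ys zero)`, a polynomial with P₁ = 0 and P₂ nonzero supplies
      -- the next factor 1 - P^(q-1), which is 1 over x and 0 over that y.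
      separate : (∀ y → ¬ Conjugate y) → ∀ {n} (ys : Fin n → L.Carrier) → ¬ ¬ (∃ λ V → Separating ys V)
      separate none {zero}  ys absurd = absurd ((λ _ → 1#) , const-PolyFun 1∈ , (λ _ _ → F.refl) , λ ())
      separate none {suc n} ys absurd = separate none (ys ∘ suc) λ (V , V-poly , V₁ , V₂) →
        none (ys zero) λ a a∈ P₁≈0 → decidable-stable (_ L.≟ _) λ P₂≉0 →
          absurd ((λ z → V z * zeroIndicator (eval a z))
            , *-PolyFun V-poly (zeroIndicator-PolyFun (eval-PolyFun a∈))
            , (λ z z₁≈x → F.trans
                 (F.*-cong (V₁ z z₁≈x) (F.trans (F.reflexive (zeroIndicator-proj₁ (eval a z)))
                   (isZero-yes F m cardF (F.trans (change₁ a z₁≈x) P₁≈0))))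
                 (F.*-identityˡ _))
            , λ { zero    z z₂≈y → L.trans
                    (L.*-congˡ (L.trans (L.reflexive (zeroIndicator-proj₂ (eval a z)))
                      (isZero-no L m cardL (P₂≉0 ∘ L.trans (L.sym (change₂ a z₂≈y))))))
                    (L.zeroʳ _)
                ; (suc i) z z₂≈y → L.trans (L.*-congʳ (V₂ i z z₂≈y)) (L.zeroˡ _) })
        where
        change₁ : ∀ {y z} (a : Fin q → Carrier) → proj₁ z F.≈ x → proj₁ (eval a z) F.≈ proj₁ (eval a (x , y))
        change₁ {y} {z} a z₁≈x = F.trans (F.reflexive (eval-proj₁ a z))
          (F.trans (F.eval-cong (proj₁ ∘ a) z₁≈x) (F.reflexive (≡.sym (eval-proj₁ a (x , y)))))
        change₂ : ∀ {y z} (a : Fin q → Carrier) → proj₂ z L.≈ y → proj₂ (eval a z) L.≈ proj₂ (eval a (x , y))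
        change₂ {y} {z} a z₂≈y = L.trans (L.reflexive (eval-proj₂ a z))
          (L.trans (L.eval-cong (proj₂ ∘ a) z₂≈y) (L.reflexive (≡.sym (eval-proj₂ a (x , y)))))

      -- A separating function for all of L has degree less than q and vanishes on L, so its
      -- coefficients vanish, contradicting its value 1 at x.
      conjugate-exists : ¬ ¬ (∃ λ y → Conjugate y)
      conjugate-exists none = separate (λ y conj → none (y , conj)) L.element λ (V , (a , a∈ , V≈) , V₁ , V₂) →
        let a₂≈0 = vanishing⇒zero L (proj₂ ∘ a) L.element L.element-injective λ i →
              L.trans (L.reflexive (≡.sym (eval-proj₂ a (x , L.element i))))
                (L.trans (L.sym (proj₂ (V≈ (x , L.element i)))) (V₂ i (x , L.element i) L.refl))
        in F.1≉0 (F.trans (F.sym (V₁ (x , L.0#) F.refl)) (F.trans (proj₁ (V≈ (x , L.0#)))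
             (F.trans (F.reflexive (eval-proj₁ a (x , L.0#))) (F.eval-zero (λ i → 0↤0 (a∈ i) (a₂≈0 i)) x))))

      module _ (y : L.Carrier) (conjugate : Conjugate y) where

        Adjoin : Carrier → Set g
        Adjoin z = ∃ λ (a : Fin q → Carrier) → (∀ i → G (a i)) × z ≈ eval a (x , y)

        Adjoin-resp : ∀ {z w} → z ≈ w → Adjoin w → Adjoin z
        Adjoin-resp z≈w (a , a∈ , w≈) = a , a∈ , trans z≈w w≈

        value : ∀ {f} → PolyFun f → Adjoin (f (x , y))
        value (a , a∈ , f≈) = a , a∈ , f≈ (x , y)

        ⊆Adjoin : ∀ {z} → G z → Adjoin z
        ⊆Adjoin z∈ = value (const-PolyFun z∈)

        x↦y : Adjoin (x , y)
        x↦y = Adjoin-resp (sym (*-identityʳ (x , y))) (value (variable-PolyFun (const-PolyFun 1∈)))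

        adjoin-graph : HomGraph Adjoin
        adjoin-graph = record
          { 1∈  = ⊆Adjoin 1∈
          ; -1∈ = ⊆Adjoin -1∈
          ; 0∈  = ⊆Adjoin 0∈
          ; +∈  = λ { (a , a∈ , z≈) (b , b∈ , w≈) →
              Adjoin-resp (+-cong z≈ w≈) (value (+-PolyFun (eval-PolyFun a∈) (eval-PolyFun b∈))) }
          ; *∈  = λ { (a , a∈ , z≈) (b , b∈ , w≈) →
              Adjoin-resp (*-cong z≈ w≈) (value (*-PolyFun (eval-PolyFun a∈) (eval-PolyFun b∈))) }
          ; 0↦0 = λ { (a , a∈ , z≈) z₁≈0 →
              L.trans (proj₂ z≈) (conjugate a a∈ (F.trans (F.sym (proj₁ z≈)) z₁≈0)) }
          }

  -- The lift puts the starting predicate at level `g`, which `Adjoin` preserves, so the induction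
  -- stays in one universe.
  Prime : Carrier → Set g
  Prime z = Lift g (∃ λ n → z ≈ n · 1#)

  prime-graph : HomGraph Prime
  prime-graph = record
    { 1∈  = lift (1 , sym (×-homo-1 1#))
    ; -1∈ = lift (suc m
        , F.trans (-1≈[q-1]·1 F m cardF) (F.reflexive (≡.sym (×-proj₁ (suc m))))
        , L.trans (-1≈[q-1]·1 L m cardL) (L.reflexive (≡.sym (×-proj₂ (suc m)))))
    ; 0∈  = lift (0 , refl)
    ; +∈  = λ { (lift (n , z≈)) (lift (k , w≈)) →
        lift (n ℕ.+ k , trans (+-cong z≈ w≈) (sym (×-homo-+ 1# n k))) }
    ; *∈  = λ { (lift (n , z≈)) (lift (k , w≈)) →
        lift (n ℕ.* k , trans (*-cong z≈ w≈) (sym (×1-homo-* n k))) }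
    ; 0↦0 = λ { (lift (n , z≈)) z₁≈0 →
        let (k , n^q≡qk) = F.q∣n^q n (F.trans (F.reflexive (≡.sym (×-proj₁ n))) (F.trans (F.sym (proj₁ z≈)) z₁≈0))
        in L.trans (proj₂ z≈) (L.trans (L.reflexive (×-proj₂ n)) (q∣n^q⇒n·1≈0 L m cardL n k n^q≡qk)) }
    }

  graph-exists : ∀ {n} (xs : Fin n → F.Carrier) →
    ¬ ¬ (∃ λ G → HomGraph G × (∀ i → ∃ λ y → G (xs i , y)))
  graph-exists {zero}  xs absurd = absurd (Prime , prime-graph , λ ())
  graph-exists {suc n} xs absurd = graph-exists (xs ∘ suc) λ (G , graph , xs∈) →
    let open Extension graph in conjugate-exists (xs zero) λ (y , conjugate) →
      absurd (Adjoin (xs zero) y conjugate , adjoin-graph (xs zero) y conjugate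
        , λ { zero    → y , x↦y (xs zero) y conjugate
            ; (suc i) → proj₁ (xs∈ i) , ⊆Adjoin (xs zero) y conjugate (proj₂ (xs∈ i)) })

  -- A table of q values with the laws in relational form: they are checked by finitely many
  -- decisions, and `functional` delivers them directly.
  IsHom : (Fin q → L.Carrier) → Set _
  IsHom φ = (∀ i j k → F.element i F.+ F.element j F.≈ F.element k → φ i L.+ φ j L.≈ φ k)
    × (∀ i j k → F.element i F.* F.element j F.≈ F.element k → φ i L.* φ j L.≈ φ k)
    × (∀ i → F.element i F.≈ F.1# → φ i L.≈ L.1#)

  isHom? : ∀ φ → Dec (IsHom φ)
  isHom? φ =
    all? (λ i → all? λ j → all? λ k → (_ F.≟ _) →-dec (_ L.≟ _))
    ×-dec all? (λ i → all? λ j → all? λ k → (_ F.≟ _) →-dec (_ L.≟ _))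
    ×-dec all? (λ i → (_ F.≟ _) →-dec (_ L.≟ _))

  IsHom-resp : ∀ {φ ψ} → (∀ i → φ i L.≈ ψ i) → IsHom φ → IsHom ψ
  IsHom-resp φ≈ψ (hom-+ , hom-* , hom-1) =
    (λ i j k eq → L.trans (L.sym (L.+-cong (φ≈ψ i) (φ≈ψ j))) (L.trans (hom-+ i j k eq) (φ≈ψ k))) ,
    (λ i j k eq → L.trans (L.sym (L.*-cong (φ≈ψ i) (φ≈ψ j))) (L.trans (hom-* i j k eq) (φ≈ψ k))) ,
    (λ i eq → L.trans (L.sym (φ≈ψ i)) (hom-1 i eq))

  hom-¬¬exists : ¬ ¬ ∃ IsHom
  hom-¬¬exists absurd = graph-exists F.element λ (G , graph , φ∈) →
    let open HomGraph graph
    in absurd ((λ i → proj₁ (φ∈ i))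
      , (λ i j k eq → functional (+∈ (proj₂ (φ∈ i)) (proj₂ (φ∈ j))) (proj₂ (φ∈ k)) eq)
      , (λ i j k eq → functional (*∈ (proj₂ (φ∈ i)) (proj₂ (φ∈ j))) (proj₂ (φ∈ k)) eq)
      , (λ i eq → functional (proj₂ (φ∈ i)) 1∈ eq))

  isomorphism : FieldIso F L
  isomorphism with ∃-dec (→-enumeration (enumerated {_∼_ = L._≈_} L.element λ y → L.index y , L.element-index y) q)
                     IsHom-resp isHom?
  ... | no none = ⊥-elim (hom-¬¬exists none)
  ... | yes (φ , hom-+ , hom-* , hom-1) = record
    { to        = to
    ; to-cong   = to-cong
    ; to-+      = to-+
    ; to-*      = to-*
    ; to-0      = to-0
    ; injective = λ {x} {y} eq → F.trans (F.element-index x)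
        (F.trans (F.reflexive (≡.cong F.element (φ-injective _ _ eq))) (F.sym (F.element-index y)))
    ; from      = from
    ; to-from   = λ y → L.trans (L.reflexive (≡.cong φ (F.index-element _))) (proj₂ (surjective y))
    }
    where
    to : F.Carrier → L.Carrier
    to x = φ (F.index x)

    to-cong : ∀ {x y} → x F.≈ y → to x L.≈ to y
    to-cong x≈y = L.reflexive (≡.cong φ (F.index-cong x≈y))

    to-+ : ∀ x y → to (x F.+ y) L.≈ to x L.+ to y
    to-+ x y = L.sym (hom-+ _ _ _ (F.trans
      (F.sym (F.+-cong (F.element-index x) (F.element-index y))) (F.element-index _)))

    to-* : ∀ x y → to (x F.* y) L.≈ to x L.* to y
    to-* x y = L.sym (hom-* _ _ _ (F.trans
      (F.sym (F.*-cong (F.element-index x) (F.element-index y))) (F.element-index _)))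

    to-1 : to F.1# L.≈ L.1#
    to-1 = hom-1 _ (F.sym (F.element-index F.1#))

    to-0 : to F.0# L.≈ L.0#
    to-0 = LP.identityʳ-unique (to F.0#) (to F.0#)
      (L.trans (L.sym (to-+ F.0# F.0#)) (to-cong (F.+-identityˡ F.0#)))
      where module LP = GroupProperties L.+-group

    kernel-trivial : ∀ x → to x L.≈ L.0# → x F.≈ F.0#
    kernel-trivial x to-x≈0 = decidable-stable (x F.≟ F.0#) λ x≉0 →
      let (x′ , xx′≈1) = F.inverse x x≉0
      in L.1≉0 (L.trans (L.sym to-1) (L.trans (to-cong (F.sym xx′≈1))
           (L.trans (to-* x x′) (L.trans (L.*-congʳ to-x≈0) (L.zeroˡ _)))))

    -- Additivity applied to (x - y) + y = x puts the difference of the two elements in the kernel.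
    φ-injective : ∀ i j → φ i L.≈ φ j → i ≡ j
    φ-injective i j φi≈φj = F.element-injective i j (FP.x∙y⁻¹≈ε⇒x≈y _ _ (kernel-trivial _ (LP.identityˡ-unique _ (φ j)
      (L.trans (hom-+ _ _ i (F.trans (F.+-congʳ (F.sym (F.element-index _))) (FP.//-rightDividesˡ _ _))) φi≈φj))))
      where
      module FP = GroupProperties F.+-group
      module LP = GroupProperties L.+-group

    surjective : ∀ y → ∃ λ i → φ i L.≈ y
    surjective y with injective⇒surjective (L.index ∘ φ)
      (λ i j eq → φ-injective i j (L.trans (L.element-index _)
        (L.trans (L.reflexive (≡.cong L.element eq)) (L.sym (L.element-index _))))) (L.index y)
    ... | i , eq = i , L.trans (L.element-index _)
        (L.trans (L.reflexive (≡.cong L.element eq)) (L.sym (L.element-index y)))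

    from : L.Carrier → F.Carrier
    from y = F.element (proj₁ (surjective y))

-- Order and addition on values

fin-injective : ∀ {a b} → fin a ≡ fin b → a ≡ b
fin-injective ≡.refl = ≡.refl

≤∞-refl : ∀ {x} → x ≤∞ x
≤∞-refl {fin a} = fin≤fin ℤ.≤-refl
≤∞-refl {∞}     = ∞ ≤∞∞

≤∞-reflexive : ∀ {x y} → x ≡ y → x ≤∞ y
≤∞-reflexive ≡.refl = ≤∞-refl

≤∞-trans : ∀ {x y z} → x ≤∞ y → y ≤∞ z → x ≤∞ z
≤∞-trans (fin≤fin a≤b) (fin≤fin b≤c) = fin≤fin (ℤ.≤-trans a≤b b≤c)
≤∞-trans {x} _         (_ ≤∞∞)       = x ≤∞∞

≤∞-antisym : ∀ {x y} → x ≤∞ y → y ≤∞ x → x ≡ y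
≤∞-antisym (fin≤fin a≤b) (fin≤fin b≤a) = ≡.cong fin (ℤ.≤-antisym a≤b b≤a)
≤∞-antisym (.∞ ≤∞∞)      (_ ≤∞∞)       = ≡.refl

infix 4 _≤∞?_
_≤∞?_ : ∀ x y → Dec (x ≤∞ y)
x     ≤∞? ∞     = yes (x ≤∞∞)
∞     ≤∞? fin b = no λ ()
fin a ≤∞? fin b = map′ fin≤fin (λ { (fin≤fin a≤b) → a≤b }) (a ℤ.≤? b)

min∞-≤ˡ : ∀ x y → min∞ x y ≤∞ x
min∞-≤ˡ (fin a) (fin b) = fin≤fin (ℤ.i⊓j≤i a b)
min∞-≤ˡ (fin a) ∞       = ≤∞-refl
min∞-≤ˡ ∞       y       = y ≤∞∞

min∞-≤ʳ : ∀ x y → min∞ x y ≤∞ y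
min∞-≤ʳ (fin a) (fin b) = fin≤fin (ℤ.i⊓j≤j a b)
min∞-≤ʳ (fin a) ∞       = fin a ≤∞∞
min∞-≤ʳ ∞       y       = ≤∞-refl

min∞-glb : ∀ {t x y} → t ≤∞ x → t ≤∞ y → t ≤∞ min∞ x y
min∞-glb (fin≤fin t≤a) (fin≤fin t≤b) = fin≤fin (ℤ.⊓-glb t≤a t≤b)
min∞-glb (fin≤fin t≤a) (_ ≤∞∞)       = fin≤fin t≤a
min∞-glb (_ ≤∞∞)       t≤y           = t≤y

minF-≤ : ∀ {m} (f : Fin m → ℤ∞) i → minF m f ≤∞ f i
minF-≤ {suc m} f zero    = min∞-≤ˡ (f zero) _
minF-≤ {suc m} f (suc i) = ≤∞-trans (min∞-≤ʳ (f zero) _) (minF-≤ (f ∘ suc) i)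

minF-glb : ∀ {m t} (f : Fin m → ℤ∞) → (∀ i → t ≤∞ f i) → t ≤∞ minF m f
minF-glb {zero}  {t} f t≤f = t ≤∞∞
minF-glb {suc m}     f t≤f = min∞-glb (t≤f zero) (minF-glb (f ∘ suc) (t≤f ∘ suc))

minF-cong : ∀ {m} {f g : Fin m → ℤ∞} → (∀ i → f i ≡ g i) → minF m f ≡ minF m g
minF-cong {zero}  f≡g = ≡.refl
minF-cong {suc m} f≡g = ≡.cong₂ min∞ (f≡g zero) (minF-cong (f≡g ∘ suc))

+∞-mono : ∀ {s t x y} → s ≤∞ x → t ≤∞ y → (s +∞ t) ≤∞ (x +∞ y)
+∞-mono {x = fin a} (fin≤fin s≤a) (fin≤fin t≤b) = fin≤fin (ℤ.+-mono-≤ s≤a t≤b)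
+∞-mono {x = fin a} _             (_ ≤∞∞)       = _ ≤∞∞
+∞-mono {x = ∞}     _             _             = _ ≤∞∞

+∞-cancelˡ : ∀ b {a t} → fin (b ℤ.+ a) ≤∞ (fin b +∞ t) → fin a ≤∞ t
+∞-cancelˡ b {a} {fin c} (fin≤fin b+a≤b+c) = fin≤fin (≡.subst₂ ℤ._≤_ (cancel a) (cancel c)
  (ℤ.+-monoʳ-≤ (ℤ.- b) b+a≤b+c))
  where
  cancel : ∀ x → ℤ.- b ℤ.+ (b ℤ.+ x) ≡ x
  cancel x = ≡.trans (≡.sym (ℤ.+-assoc (ℤ.- b) b x))
    (≡.trans (≡.cong (ℤ._+ x) (ℤ.+-inverseˡ b)) (ℤ.+-identityˡ x))
+∞-cancelˡ b {t = ∞}     _            = _ ≤∞∞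

-- Discreteness of the valuation enters here: no value lies strictly between z and z + 1.
≰∞⇒suc≤ : ∀ {z x} → ¬ x ≤∞ fin z → fin (ℤ.suc z) ≤∞ x
≰∞⇒suc≤ {x = fin a} x≰z = fin≤fin (ℤ.i<j⇒suc[i]≤j (ℤ.≰⇒> (x≰z ∘ fin≤fin)))
≰∞⇒suc≤ {x = ∞}     x≰z = _ ≤∞∞

suc≰∞ : ∀ {z} → ¬ fin (ℤ.suc z) ≤∞ fin z
suc≰∞ {z} (fin≤fin suc≤z) = ℤ.<-irrefl ≡.refl (ℤ.suc[i]≤j⇒i<j {z} suc≤z)

-- The residue field

module Valuation {c ℓ} (K : Field c ℓ) (V : DiscreteValuation K) where
  open Field K hiding (zero)
  open DiscreteValuation V
  open Valued K V
  open FieldProperties K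
  open AbelianGroupProperties +-abelianGroup using (⁻¹-∙-comm)
  open GroupProperties +-group using (⁻¹-involutive; ε⁻¹≈ε)
  open RingProperties ring using (-1*x≈-x; x[y-z]≈xy-xz; [y-z]x≈yx-zx)
  open SetoidReasoning setoid

  ν-1 : ν 1# ≡ fin (ℤ.+ 0)
  ν-1 with ν 1# in eq
  ... | ∞     = ⊥-elim (1≉0 (ν-∞⇒0 1# eq))
  ... | fin a = ≡.cong fin (x+x≈x⇒x≈0 a (fin-injective
    (≡.trans (≡.sym (≡.cong₂ _+∞_ eq eq)) (≡.trans (≡.sym (ν-* 1# 1#)) (≡.trans (ν-cong (*-identityˡ 1#)) eq)))))
    where open RingProperties ℤ.+-*-ring using (x+x≈x⇒x≈0)

  ν-≥0 : ∀ {t} → t ≤∞ ν 0#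
  ν-≥0 {t} = ≡.subst (t ≤∞_) (≡.sym ν-0) (t ≤∞∞)

  ν-≥-cong : ∀ {t x y} → x ≈ y → t ≤∞ ν x → t ≤∞ ν y
  ν-≥-cong {t} x≈y = ≡.subst (t ≤∞_) (ν-cong x≈y)

  ν-≥+ : ∀ {t x y} → t ≤∞ ν x → t ≤∞ ν y → t ≤∞ ν (x + y)
  ν-≥+ {x = x} {y} t≤x t≤y = ≤∞-trans (min∞-glb t≤x t≤y) (ν-+ x y)

  ν-≥* : ∀ {s t x y} → s ≤∞ ν x → t ≤∞ ν y → (s +∞ t) ≤∞ ν (x * y)
  ν-≥* {s} {t} {x} {y} s≤x t≤y = ≡.subst ((s +∞ t) ≤∞_) (≡.sym (ν-* x y)) (+∞-mono s≤x t≤y)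

  1∈𝒪 : In𝒪 1#
  1∈𝒪 = ≤∞-reflexive (≡.sym ν-1)

  -- Twice the value of -1 is the value of 1, which is 0, so it cannot be negative. Closure of 𝒪 and
  -- 𝔪 under negation rests on this.
  -1∈𝒪 : In𝒪 (- 1#)
  -1∈𝒪 with ν (- 1#) in eq
  ... | ∞     = _ ≤∞∞
  ... | fin a = fin≤fin (ℤ.≮⇒≥ λ a<0 → ℤ.<-irrefl a+a≡0 (ℤ.+-mono-< a<0 a<0))
    where
    a+a≡0 : a ℤ.+ a ≡ ℤ.+ 0
    a+a≡0 = fin-injective (≡.trans (≡.sym (≡.cong₂ _+∞_ eq eq)) (≡.trans (≡.sym (ν-* (- 1#) (- 1#)))
      (≡.trans (ν-cong (trans (-1*x≈-x _) (⁻¹-involutive 1#))) ν-1)))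

  ν-≥- : ∀ {z x} → fin z ≤∞ ν x → fin z ≤∞ ν (- x)
  ν-≥- {z} {x} z≤x = ν-≥-cong (-1*x≈-x x)
    (≡.subst (_≤∞ ν (- 1# * x)) (≡.cong fin (ℤ.+-identityˡ z)) (ν-≥* -1∈𝒪 z≤x))

  x-0≈x : ∀ x → x - 0# ≈ x
  x-0≈x x = trans (+-congˡ ε⁻¹≈ε) (+-identityʳ x)

  telescope : ∀ x y z → (x - y) + (y - z) ≈ x - z
  telescope x y z = begin
    (x - y) + (y - z)    ≈⟨ +-assoc x (- y) (y - z) ⟩
    x + (- y + (y - z))  ≈⟨ +-congˡ (+-assoc (- y) y (- z)) ⟨
    x + ((- y + y) - z)  ≈⟨ +-congˡ (+-congʳ (-‿inverseˡ y)) ⟩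
    x + (0# - z)         ≈⟨ +-congˡ (+-identityˡ (- z)) ⟩
    x - z                ∎

  -‿swap : ∀ x y → - (x - y) ≈ y - x
  -‿swap x y = trans (sym (⁻¹-∙-comm x (- y))) (trans (+-congˡ (⁻¹-involutive y)) (+-comm (- x) y))

  differences : ∀ x y u v → (x - y) + (u - v) ≈ (x + u) - (y + v)
  differences x y u v = begin
    (x - y) + (u - v)        ≈⟨ +-assoc x (- y) _ ⟩
    x + (- y + (u - v))      ≈⟨ +-congˡ (+-assoc (- y) u (- v)) ⟨
    x + ((- y + u) - v)      ≈⟨ +-congˡ (+-congʳ (+-comm (- y) u)) ⟩
    x + ((u - y) - v)        ≈⟨ +-congˡ (+-assoc u (- y) (- v)) ⟩
    x + (u + (- y - v))      ≈⟨ +-assoc x u _ ⟨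
    (x + u) + (- y - v)      ≈⟨ +-congˡ (⁻¹-∙-comm y v) ⟩
    (x + u) - (y + v)        ∎

  𝒪 : Set c
  𝒪 = Σ Carrier In𝒪

  infix 4 _≈κ_
  -- The quotient 𝒪/𝔪 is realized by coarsening equality on 𝒪. The relation is decidable because
  -- values are compared by `_≤∞?_`.
  _≈κ_ : 𝒪 → 𝒪 → Set
  (x , _) ≈κ (y , _) = In𝔪 (x - y)

  ≈⇒≈κ : ∀ {x y : 𝒪} → proj₁ x ≈ proj₁ y → x ≈κ y
  ≈⇒≈κ {x , _} {y , _} x≈y = ν-≥-cong (sym (trans (+-congʳ x≈y) (-‿inverseʳ y))) ν-≥0

  ≈κ-sym : ∀ {x y} → x ≈κ y → y ≈κ x
  ≈κ-sym {x , _} {y , _} x≈y = ν-≥-cong (-‿swap x y) (ν-≥- x≈y)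

  residueRing : CommutativeRing c 0ℓ
  residueRing = record
    { Carrier = 𝒪
    ; _≈_     = _≈κ_
    ; _+_     = λ (x , x∈) (y , y∈) → x + y , ν-≥+ x∈ y∈
    ; _*_     = λ (x , x∈) (y , y∈) → x * y , ν-≥* x∈ y∈
    ; -_      = λ (x , x∈) → - x , ν-≥- x∈
    ; 0#      = 0# , ν-≥0
    ; 1#      = 1# , 1∈𝒪
    ; isCommutativeRing = record
      { isRing = record
        { +-isAbelianGroup = record
          { isGroup = record
            { isMonoid = record
              { isSemigroup = record
                { isMagma = record
                  { isEquivalence = record
                    { refl  = λ {x} → ≈⇒≈κ {x} {x} refl
                    ; sym   = λ {x} {y} → ≈κ-sym {x} {y}
                    ; trans = λ {(x , _)} {(y , _)} {(z , _)} x≈y y≈z →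
                        ν-≥-cong (telescope x y z) (ν-≥+ x≈y y≈z)
                    }
                  ; ∙-cong = λ {(x , _)} {(y , _)} {(u , _)} {(v , _)} x≈y u≈v →
                      ν-≥-cong (differences x y u v) (ν-≥+ x≈y u≈v)
                  }
                ; assoc = λ (x , x∈) (y , y∈) (z , z∈) →
                    ≈⇒≈κ {_ , ν-≥+ (ν-≥+ x∈ y∈) z∈} {_ , ν-≥+ x∈ (ν-≥+ y∈ z∈)} (+-assoc x y z)
                }
              ; identity = (λ (x , x∈) → ≈⇒≈κ {_ , ν-≥+ ν-≥0 x∈} {x , x∈} (+-identityˡ x))
                         , (λ (x , x∈) → ≈⇒≈κ {_ , ν-≥+ x∈ ν-≥0} {x , x∈} (+-identityʳ x))
              }
            ; inverse = (λ (x , x∈) → ≈⇒≈κ {_ , ν-≥+ (ν-≥- x∈) x∈} {0# , ν-≥0} (-‿inverseˡ x))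
                      , (λ (x , x∈) → ≈⇒≈κ {_ , ν-≥+ x∈ (ν-≥- x∈)} {0# , ν-≥0} (-‿inverseʳ x))
            ; ⁻¹-cong = λ {(x , _)} {(y , _)} x≈y →
                ν-≥-cong (sym (⁻¹-∙-comm x (- y))) (ν-≥- x≈y)
            }
          ; comm = λ (x , x∈) (y , y∈) → ≈⇒≈κ {_ , ν-≥+ x∈ y∈} {_ , ν-≥+ y∈ x∈} (+-comm x y)
          }
        -- xu - yv = x(u - v) + (x - y)v, where the bounds 0 + 1 and 1 + 0 both compute to 1.
        ; *-cong = λ {(x , x∈)} {(y , _)} {(u , _)} {(v , v∈)} x≈y u≈v →
            ν-≥-cong (trans (+-cong (x[y-z]≈xy-xz x u v) ([y-z]x≈yx-zx v x y)) (telescope (x * u) (x * v) (y * v)))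
              (ν-≥+ (ν-≥* x∈ u≈v) (ν-≥* x≈y v∈))
        ; *-assoc = λ (x , x∈) (y , y∈) (z , z∈) →
            ≈⇒≈κ {_ , ν-≥* (ν-≥* x∈ y∈) z∈} {_ , ν-≥* x∈ (ν-≥* y∈ z∈)} (*-assoc x y z)
        ; *-identity = (λ (x , x∈) → ≈⇒≈κ {_ , ν-≥* 1∈𝒪 x∈} {x , x∈} (*-identityˡ x))
                     , (λ (x , x∈) → ≈⇒≈κ {_ , ν-≥* x∈ 1∈𝒪} {x , x∈} (*-identityʳ x))
        ; distrib = (λ (x , x∈) (y , y∈) (z , z∈) →
                      ≈⇒≈κ {_ , ν-≥* x∈ (ν-≥+ y∈ z∈)} {_ , ν-≥+ (ν-≥* x∈ y∈) (ν-≥* x∈ z∈)} (distribˡ x y z))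
                  , (λ (x , x∈) (y , y∈) (z , z∈) →
                      ≈⇒≈κ {_ , ν-≥* (ν-≥+ y∈ z∈) x∈} {_ , ν-≥+ (ν-≥* y∈ x∈) (ν-≥* z∈ x∈)} (distribʳ x y z))
        }
      ; *-comm = λ (x , x∈) (y , y∈) → ≈⇒≈κ {_ , ν-≥* x∈ y∈} {_ , ν-≥* y∈ x∈} (*-comm x y)
      }
    }

  private module R = CommutativeRing residueRing

  ≈κ0⇒∈𝔪 : ∀ x → x ≈κ R.0# → In𝔪 (proj₁ x)
  ≈κ0⇒∈𝔪 (x , _) = ν-≥-cong (x-0≈x x)

  ∈𝔪⇒≈κ0 : ∀ x → In𝔪 (proj₁ x) → x ≈κ R.0#
  ∈𝔪⇒≈κ0 (x , _) = ν-≥-cong (sym (x-0≈x x))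

  -- Outside 𝔪 the value of x is at most 0, and the values of x and y add up to 0.
  ν-unit-inverse : ∀ {x y} → In𝒪 x → ¬ In𝔪 x → x * y ≈ 1# → In𝒪 y
  ν-unit-inverse {x} {y} x∈𝒪 x∉𝔪 xy≈1 with ν x in νx | ν y in νy | ≡.trans (≡.sym (ν-* x y)) (≡.trans (ν-cong xy≈1) ν-1)
  ... | ∞     | _     | _  = ⊥-elim (x∉𝔪 (_ ≤∞∞))
  ... | fin a | ∞     | _  = _ ≤∞∞
  ... | fin a | fin b | eq = +∞-cancelˡ a (≤∞-trans (fin≤fin a+0≤0) (≤∞-reflexive (≡.sym eq)))
    where
    a≤0 : a ℤ.≤ ℤ.+ 0
    a≤0 = ℤ.≮⇒≥ λ 0<a → x∉𝔪 (fin≤fin (ℤ.i<j⇒suc[i]≤j 0<a))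
    a+0≤0 : a ℤ.+ ℤ.+ 0 ℤ.≤ ℤ.+ 0
    a+0≤0 = ≡.subst (ℤ._≤ ℤ.+ 0) (≡.sym (ℤ.+-identityʳ a)) a≤0

  1∉𝔪 : ¬ In𝔪 1#
  1∉𝔪 1∈𝔪 = suc≰∞ {ℤ.+ 0} (≡.subst (fin (ℤ.+ 1) ≤∞_) ν-1 1∈𝔪)

  residueField : Field c 0ℓ
  residueField = record
    { commutativeRing = residueRing
    ; 0≉1     = λ 0≈1 → 1∉𝔪 (≈κ0⇒∈𝔪 R.1# (≈κ-sym {R.0#} {R.1#} 0≈1))
    ; inverse = invert
    }
    where
    invert : ∀ x → ¬ x ≈κ R.0# → ∃ λ y → x R.* y ≈κ R.1#
    invert (x , x∈) x≉0 with inverse x (λ x≈0 → x≉0 (≈⇒≈κ {x , x∈} {R.0#} x≈0))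
    ... | y , xy≈1 = (y , y∈) , ≈⇒≈κ {(x , x∈) R.* (y , y∈)} {R.1#} xy≈1
      where
      y∈ : In𝒪 y
      y∈ = ν-unit-inverse x∈ (λ x∈𝔪 → x≉0 (∈𝔪⇒≈κ0 (x , x∈) x∈𝔪)) xy≈1

  residueField-card : ∀ {q} → ResidueCard q → Projective.HasCard residueField q
  residueField-card (r , r∈ , cover , distinct) =
    (λ i → r i , r∈ i) , (λ (x , x∈) → cover x x∈) , distinct

-- By integrality s is at most z - 1, which leaves at least 1 for t. A failed bound on a coefficient
-- thus forces all entries of its vector into 𝔪.
≰∞-cancelˡ : ∀ {z s t} → ¬ fin z ≤∞ s → fin z ≤∞ (s +∞ t) → fin (ℤ.+ 1) ≤∞ t
≰∞-cancelˡ {s = ∞}         z≰∞ _     = ⊥-elim (z≰∞ (_ ≤∞∞))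
≰∞-cancelˡ {z} {s = fin b} z≰b z≤b+t = +∞-cancelˡ b (≤∞-trans (fin≤fin b+1≤z) z≤b+t)
  where
  b+1≤z : b ℤ.+ ℤ.+ 1 ℤ.≤ z
  b+1≤z = ≡.subst (ℤ._≤ z) (ℤ.+-comm (ℤ.+ 1) b) (ℤ.i<j⇒suc[i]≤j (ℤ.≰⇒> (z≰b ∘ fin≤fin)))

-z+suc[z]≡1 : ∀ z → ℤ.- z ℤ.+ ℤ.suc z ≡ ℤ.+ 1
-z+suc[z]≡1 z = ≡.trans (≡.cong (λ t → ℤ.- z ℤ.+ t) (ℤ.+-comm (ℤ.+ 1) z))
  (≡.trans (≡.sym (ℤ.+-assoc (ℤ.- z) z (ℤ.+ 1))) (≡.cong (ℤ._+ ℤ.+ 1) (ℤ.+-inverseˡ z)))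

-- Orthogonality and independence of reductions

module LinearCombinations {c ℓ} (K : Field c ℓ) where
  open Field K hiding (zero)
  open LinAlg K

  lincomb-cong : ∀ {n} m {a b : Fin m → Carrier} {us vs : Fin m → Vecᴷ n} →
    (∀ i j → a i * us i j ≈ b i * vs i j) → lincomb m a us ≈v lincomb m b vs
  lincomb-cong zero    eq j = refl
  lincomb-cong (suc m) eq j = +-cong (eq zero j) (lincomb-cong m (eq ∘ suc) j)

  lincomb-scale : ∀ {n} m x (a : Fin m → Carrier) (us : Fin m → Vecᴷ n) j →
    lincomb m (λ i → x * a i) us j ≈ x * lincomb m a us j
  lincomb-scale zero    x a us j = sym (zeroʳ x)
  lincomb-scale (suc m) x a us j = trans
    (+-cong (*-assoc x (a zero) (us zero j)) (lincomb-scale m x (a ∘ suc) (us ∘ suc) j))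
    (sym (distribˡ x _ _))

module Orthogonality {c ℓ} (K : Field c ℓ) (V : DiscreteValuation K) where
  open Field K hiding (zero)
  open DiscreteValuation V
  open Valued K V
  open LinAlg K
  open FieldProperties K
  open Valuation K V
  open LinearCombinations K
  private
    module κ = Field residueField
    module κˡ = LinAlg residueField

  νv-cong : ∀ {n} {u v : Vecᴷ n} → u ≈v v → νv u ≡ νv v
  νv-cong u≈v = minF-cong (ν-cong ∘ u≈v)

  -- Orthogonality ranges over all coefficients, so the scalars are absorbed into them: b v = (b a)
  -- u.
  orthogonal-scale : ∀ {n m} {us vs : Fin m → Vecᴷ n} (a : Fin m → Carrier) → (∀ i → ¬ a i ≈ 0#) →
    (∀ i j → vs i j ≈ a i * us i j) → Orthogonal us → Orthogonal vs
  orthogonal-scale {m = m} {us} {vs} a a≉0 vs≈ (us≉0 , orth) =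
    (λ i vs≈0 → us≉0 i λ j → zero-product (a≉0 i) (trans (sym (vs≈ i j)) (vs≈0 j))) ,
    λ b → ≡.trans (νv-cong (lincomb-cong m (scaled b)))
      (≡.trans (orth (λ i → b i * a i)) (minF-cong λ i → νv-cong λ j → sym (scaled b i j)))
    where
    scaled : ∀ b i j → b i * vs i j ≈ b i * a i * us i j
    scaled b i j = trans (*-congˡ (vs≈ i j)) (sym (*-assoc (b i) (a i) (us i j)))

  embed : ∀ {n} → κˡ.Vecᴷ n → Vecᴷ n
  embed u j = proj₁ (u j)

  embed-lincomb : ∀ {n} m (b : Fin m → κ.Carrier) (us : Fin m → κˡ.Vecᴷ n) j →
    proj₁ (κˡ.lincomb m b us j) ≡ lincomb m (proj₁ ∘ b) (embed ∘ us) j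
  embed-lincomb zero    b us j = ≡.refl
  embed-lincomb (suc m) b us j = ≡.cong (proj₁ (b zero) * proj₁ (us zero j) +_) (embed-lincomb m (b ∘ suc) (us ∘ suc) j)

  embed-NonZero : ∀ {n} {u : κˡ.Vecᴷ n} → κˡ.NonZero u → NonZero (embed u)
  embed-NonZero {u = u} u≉0 embed≈0 = u≉0 λ j → ≈⇒≈κ {u j} {κ.0#} (embed≈0 j)

  -- The reduction of u being nonzero, embed u has norm 1.
  ν-≥-unscale : ∀ {n z a} {u : κˡ.Vecᴷ n} → κˡ.NonZero u → fin z ≤∞ νv (a ·v embed u) → fin z ≤∞ ν a
  ν-≥-unscale {z = z} {a} {u} u≉0 z≤au = decidable-stable (fin z ≤∞? ν a) λ z≰a →
    u≉0 λ j → ∈𝔪⇒≈κ0 (u j) (≰∞-cancelˡ z≰a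
      (≡.subst (fin z ≤∞_) (ν-* a (proj₁ (u j))) (≤∞-trans z≤au (minF-≤ _ j))))

  ν-≥-scale : ∀ {n z a} {u : κˡ.Vecᴷ n} → fin z ≤∞ ν a → fin z ≤∞ νv (a ·v embed u)
  ν-≥-scale {z = z} {a} {u} z≤a = minF-glb _ λ j →
    ≡.subst (_≤∞ ν (a * proj₁ (u j))) (≡.cong fin (ℤ.+-identityʳ z)) (ν-≥* z≤a (proj₂ (u j)))

  -- A combination vanishing modulo 𝔪 has value at least 1. By orthogonality so has each term, and
  -- the vectors having norm 1, each coefficient lies in 𝔪.
  orthogonal⇒independent : ∀ {n m} {us : Fin m → κˡ.Vecᴷ n} → (∀ i → κˡ.NonZero (us i)) →
    Orthogonal (embed ∘ us) → κˡ.LinIndep us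
  orthogonal⇒independent {m = m} {us} us≉0 (_ , orth) b comb≈0 i =
    ∈𝔪⇒≈κ0 (b i) (ν-≥-unscale {u = us i} (us≉0 i) (≤∞-trans
      (≤∞-trans comb≥1 (≤∞-reflexive (orth (proj₁ ∘ b)))) (minF-≤ _ i)))
    where
    comb≥1 : fin (ℤ.+ 1) ≤∞ νv (lincomb m (proj₁ ∘ b) (embed ∘ us))
    comb≥1 = minF-glb _ λ j → ν-≥-cong (reflexive (embed-lincomb m b us j)) (≈κ0⇒∈𝔪 (κˡ.lincomb m b us j) (comb≈0 j))

  -- The ultrametric inequality, the half of orthogonality that every family satisfies.
  lincomb-ν-≥ : ∀ {n t} m (b : Fin m → Carrier) (us : Fin m → Vecᴷ n) →
    (∀ i → t ≤∞ νv (b i ·v us i)) → t ≤∞ νv (lincomb m b us)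
  lincomb-ν-≥ {t = t} m b us t≤ = minF-glb _ λ j → at j m b us λ i → ≤∞-trans (t≤ i) (minF-≤ _ j)
    where
    at : ∀ j m (b : Fin m → Carrier) us → (∀ i → t ≤∞ ν (b i * us i j)) → t ≤∞ ν (lincomb m b us j)
    at j zero    b us t≤ = ν-≥0
    at j (suc m) b us t≤ = ν-≥+ (t≤ zero) (at j m (b ∘ suc) (us ∘ suc) (t≤ ∘ suc))

  -- Rescaled so that its largest coefficient is a unit, a combination reduces to a nontrivial one
  -- over the residue field.
  independent⇒orthogonal : ∀ {n m} {us : Fin m → κˡ.Vecᴷ n} → (∀ i → κˡ.NonZero (us i)) →
    κˡ.LinIndep us → Orthogonal (embed ∘ us)
  independent⇒orthogonal {m = m} {us} us≉0 indep = (λ i → embed-NonZero {u = us i} (us≉0 i)) , λ b →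
    ≤∞-antisym (upper b _ ≡.refl) (lincomb-ν-≥ m b (embed ∘ us) (minF-≤ (terms b)))
    where
    norm : (Fin m → Carrier) → ℤ∞
    norm b = νv (lincomb m b (embed ∘ us))

    terms : (Fin m → Carrier) → Fin m → ℤ∞
    terms b i = νv (b i ·v embed (us i))

    upper : ∀ b t → minF m (terms b) ≡ t → norm b ≤∞ minF m (terms b)
    upper b ∞       eq = ≡.subst (norm b ≤∞_) (≡.sym eq) (norm b ≤∞∞)
    -- Were the combination of value above z, its multiple by `π` would vanish modulo 𝔪.
    -- Independence then puts every π b_i in 𝔪, so all terms have value at least z + 1, against
    -- their minimum z.
    upper b (fin z) eq = ≡.subst (norm b ≤∞_) (≡.sym eq) (decidable-stable (norm b ≤∞? fin z) λ comb≰z →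
      suc≰∞ (≡.subst (fin (ℤ.suc z) ≤∞_) eq
        (minF-glb (terms b) λ i → ν-≥-scale {u = us i} (b≥suc (≰∞⇒suc≤ comb≰z) i))))
      where
      -- Not a uniformizer: any element of value -z.
      π : Carrier
      π = proj₁ (ν-surj (ℤ.- z))

      ν-π : ν π ≡ fin (ℤ.- z)
      ν-π = proj₂ (ν-surj (ℤ.- z))

      ν-π* : ∀ {y w x} → ℤ.- z ℤ.+ y ≡ w → fin y ≤∞ ν x → fin w ≤∞ ν (π * x)
      ν-π* {x = x} eq y≤x = ≡.subst (_≤∞ ν (π * x)) (≡.cong fin eq) (ν-≥* (≤∞-reflexive (≡.sym ν-π)) y≤x)

      πb : Fin m → κ.Carrier
      πb i = π * b i , ν-π* (ℤ.+-inverseˡ z)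
        (ν-≥-unscale {u = us i} (us≉0 i) (≤∞-trans (≤∞-reflexive (≡.sym eq)) (minF-≤ (terms b) i)))

      module _ (suc≤comb : fin (ℤ.suc z) ≤∞ norm b) where

        comb≈0 : κˡ.lincomb m πb us κˡ.≈v κˡ.0v
        comb≈0 j = ∈𝔪⇒≈κ0 (κˡ.lincomb m πb us j) (ν-≥-cong
          (trans (sym (lincomb-scale m π b (embed ∘ us) j)) (reflexive (≡.sym (embed-lincomb m πb us j))))
          (ν-π* (-z+suc[z]≡1 z) (≤∞-trans suc≤comb (minF-≤ _ j))))

        b≥suc : ∀ i → fin (ℤ.suc z) ≤∞ ν (b i)
        b≥suc i = +∞-cancelˡ (ℤ.- z) (≡.subst₂ _≤∞_ (≡.cong fin (≡.sym (-z+suc[z]≡1 z)))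
          (≡.trans (ν-* π (b i)) (≡.cong (_+∞ ν (b i)) ν-π)) (≈κ0⇒∈𝔪 (πb i) (indep πb comb≈0 i)))

  -- Scaling by an element of value -z, where z is the value of v, makes all entries integral. If
  -- all of them fell into 𝔪, the value of v would be at least z + 1.
  normalize : ∀ {n} (v : Vecᴷ n) → NonZero v → ∃ λ a → ¬ a ≈ 0# ×
    ∃ λ (u : κˡ.Vecᴷ n) → κˡ.NonZero u × (∀ j → embed u j ≈ a * v j)
  normalize {n} v v≉0 with νv v in eq
  ... | ∞     = ⊥-elim (v≉0 λ j → ν-∞⇒0 (v j) (≤∞-antisym (_ ≤∞∞) (≡.subst (_≤∞ ν (v j)) eq (minF-≤ _ j))))
  ... | fin z = a , a≉0 , u , u≉0 , λ j → refl
    where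
    a : Carrier
    a = proj₁ (ν-surj (ℤ.- z))

    ν-a : ν a ≡ fin (ℤ.- z)
    ν-a = proj₂ (ν-surj (ℤ.- z))

    a≉0 : ¬ a ≈ 0#
    a≉0 a≈0 with () ← ≡.trans (≡.sym ν-a) (≡.trans (ν-cong a≈0) ν-0)

    u : κˡ.Vecᴷ n
    u j = a * v j , ≡.subst (_≤∞ ν (a * v j)) (≡.cong fin (ℤ.+-inverseˡ z))
      (ν-≥* (≤∞-reflexive (≡.sym ν-a)) (≡.subst (_≤∞ ν (v j)) eq (minF-≤ _ j)))

    u≉0 : κˡ.NonZero u
    u≉0 u≈0 = suc≰∞ (≡.subst (fin (ℤ.suc z) ≤∞_) eq (minF-glb _ λ j →
      +∞-cancelˡ (ℤ.- z) (≡.subst₂ _≤∞_ (≡.cong fin (≡.sym (-z+suc[z]≡1 z)))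
        (≡.trans (ν-* a (v j)) (≡.cong (_+∞ ν (v j)) ν-a)) (≈κ0⇒∈𝔪 (u j) (u≈0 j)))))

-- Pro-independent sets: transport and decidability

module ProjectiveIndependence {c ℓ} (F : Field c ℓ) where
  open Field F using (Carrier; _≈_; 0#; 1#)
  open LinAlg F
  open Projective F

  IndependentSet : ∀ {n} → ℕ → ℕ → ∀ {M} → (Fin M → Vecᴷ n) → Set (c ⊔ ℓ)
  IndependentSet k l P = ProjPoints P × ProIndependent k l P

  HasIndependentSet : ℕ → ℕ → ℕ → ℕ → Set (c ⊔ ℓ)
  HasIndependentSet n k l M = ∃ λ (P : Fin M → Vecᴷ n) → IndependentSet k l P

-- Transport along the identity shows that independence respects pointwise equality, as the finite
-- searches require.
id-iso : ∀ {c ℓ} (F : Field c ℓ) → FieldIso F F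
id-iso F = record
  { to        = id
  ; to-cong   = id
  ; to-+      = λ _ _ → refl
  ; to-*      = λ _ _ → refl
  ; to-0      = refl
  ; injective = id
  ; from      = id
  ; to-from   = λ _ → refl
  }
  where open Field F using (refl)

module Transport {c₁ ℓ₁ c₂ ℓ₂} {F : Field c₁ ℓ₁} {L : Field c₂ ℓ₂} (iso : FieldIso F L) where
  private
    module F where
      open Field F public
      open LinAlg F public
      open Projective F public
      open ProjectiveIndependence F public
      open LinearCombinations F public
    module L where
      open Field L public
      open LinAlg L public
      open Projective L public
      open ProjectiveIndependence L public
      open LinearCombinations L public
  open FieldIso iso

  infix 4 _↦_ _↦*_
  -- A relation, so that a single argument covers `to` applied to F-vectors, `from` applied to
  -- L-vectors, and pointwise equal vectors.
  _↦_ : ∀ {n} → F.Vecᴷ n → L.Vecᴷ n → Set ℓ₂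
  u ↦ v = ∀ j → to (u j) L.≈ v j

  _↦*_ : ∀ {m n} → (Fin m → F.Vecᴷ n) → (Fin m → L.Vecᴷ n) → Set ℓ₂
  us ↦* vs = ∀ i → us i ↦ vs i

  to-injective-0 : ∀ {x} → to x L.≈ L.0# → x F.≈ F.0#
  to-injective-0 to-x≈0 = injective (L.trans to-x≈0 (L.sym to-0))

  lincomb-↦ : ∀ {n} m {a : Fin m → F.Carrier} {b : Fin m → L.Carrier}
    {us : Fin m → F.Vecᴷ n} {vs : Fin m → L.Vecᴷ n} →
    (∀ i → to (a i) L.≈ b i) → us ↦* vs → F.lincomb m a us ↦ L.lincomb m b vs
  lincomb-↦ zero    a↦b us↦vs j = to-0
  lincomb-↦ (suc m) a↦b us↦vs j = L.trans (to-+ _ _) (L.+-cong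
    (L.trans (to-* _ _) (L.*-cong (a↦b zero) (us↦vs zero j)))
    (lincomb-↦ m (a↦b ∘ suc) (us↦vs ∘ suc) j))

  LinIndep-to : ∀ {m n} {us : Fin m → F.Vecᴷ n} {vs : Fin m → L.Vecᴷ n} →
    us ↦* vs → F.LinIndep us → L.LinIndep vs
  LinIndep-to {m} us↦vs indep b comb≈0 i = L.trans (L.sym (to-from (b i))) (L.trans
    (to-cong (indep (from ∘ b) (λ j → to-injective-0 (L.trans
      (lincomb-↦ m (to-from ∘ b) us↦vs j) (comb≈0 j))) i)) to-0)

  LinIndep-from : ∀ {m n} {us : Fin m → F.Vecᴷ n} {vs : Fin m → L.Vecᴷ n} →
    us ↦* vs → L.LinIndep vs → F.LinIndep us
  LinIndep-from {m} us↦vs indep a comb≈0 i = to-injective-0 (indep (to ∘ a)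
    (λ j → L.trans (L.sym (lincomb-↦ m (λ _ → L.refl) us↦vs j)) (L.trans (to-cong (comb≈0 j)) to-0)) i)

  IndependentSet-to : ∀ {n k l M} {P : Fin M → F.Vecᴷ n} {Q : Fin M → L.Vecᴷ n} →
    P ↦* Q → F.IndependentSet k l P → L.IndependentSet k l Q
  IndependentSet-to {P = P} {Q} P↦Q ((P≉0 , P-distinct) , P-indep) =
    ( (λ i Q≈0 → P≉0 i λ j → to-injective-0 (L.trans (P↦Q i j) (Q≈0 j)))
    , (λ i i′ b Q≈bQ → P-distinct i i′ (from b) λ j → injective (L.trans (P↦Q i j) (L.trans (Q≈bQ j)
        (L.sym (L.trans (to-* _ _) (L.*-cong (to-from b) (P↦Q i′ j)))))))) ,
    λ e e-injective → let (f , f-injective , indep) = P-indep e e-injective in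
      f , f-injective , LinIndep-to (λ i → P↦Q (e (f i))) indep

  IndependentSet-from : ∀ {n k l M} {P : Fin M → F.Vecᴷ n} {Q : Fin M → L.Vecᴷ n} →
    P ↦* Q → L.IndependentSet k l Q → F.IndependentSet k l P
  IndependentSet-from {P = P} {Q} P↦Q ((Q≉0 , Q-distinct) , Q-indep) =
    ( (λ i P≈0 → Q≉0 i λ j → L.trans (L.sym (P↦Q i j)) (L.trans (to-cong (P≈0 j)) to-0))
    , (λ i i′ a P≈aP → Q-distinct i i′ (to a) λ j → L.trans (L.sym (P↦Q i j)) (L.trans (to-cong (P≈aP j))
        (L.trans (to-* _ _) (L.*-congˡ (P↦Q i′ j)))))) ,
    λ e e-injective → let (f , f-injective , indep) = Q-indep e e-injective in
      f , f-injective , LinIndep-from (λ i → P↦Q (e (f i))) indep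

  HasIndependentSet-to : ∀ {n k l M} → F.HasIndependentSet n k l M → L.HasIndependentSet n k l M
  HasIndependentSet-to (P , P-indep) =
    (λ i j → to (P i j)) , IndependentSet-to (λ i j → L.refl) P-indep

  HasIndependentSet-from : ∀ {n k l M} → L.HasIndependentSet n k l M → F.HasIndependentSet n k l M
  HasIndependentSet-from (Q , Q-indep) =
    (λ i j → from (Q i j)) , IndependentSet-from (λ i j → to-from (Q i j)) Q-indep

InjectiveF? : ∀ {a b} (f : Fin a → Fin b) → Dec (InjectiveF f)
InjectiveF? f = all? λ i → all? λ j → (f i Fin.≟ f j) →-dec (i Fin.≟ j)

InjectiveF-resp : ∀ {a b} {f g : Fin a → Fin b} → (∀ i → f i ≡ g i) → InjectiveF f → InjectiveF g
InjectiveF-resp f≗g f-injective i j gi≡gj =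
  f-injective i j (≡.trans (f≗g i) (≡.trans gi≡gj (≡.sym (f≗g j))))

module Decidability {c ℓ} (F : Field c ℓ) (m : ℕ) (card : Projective.HasCard F (2 ℕ.+ m)) where
  open Field F hiding (zero)
  open LinAlg F
  open Projective F
  open ProjectiveIndependence F
  open LinearCombinations F
  open FiniteField F m card
  open Transport (id-iso F) using (LinIndep-to; IndependentSet-to)

  enumeration : Enumeration _≈_ q
  enumeration = enumerated element λ x → index x , element-index x

  vectors : ∀ n → Enumeration (_≈v_ {n}) (q ℕ.^ n)
  vectors = →-enumeration enumeration

  LinIndep? : ∀ {n m} (us : Fin m → Vecᴷ n) → Dec (LinIndep us)
  LinIndep? {n} {m} us = ∀-dec (vectors m)
    (λ a≈b indep comb≈0 j → trans (a≈b j) (indep (λ i → trans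
       (lincomb-cong m {us = us} {us} (λ i j → *-congʳ (sym (a≈b i))) i) (comb≈0 i)) j))
    (λ a → all? (λ i → lincomb m a us i ≟ 0#) →-dec all? (λ j → a j ≟ 0#))

  ProjPoints? : ∀ {n M} (P : Fin M → Vecᴷ n) → Dec (ProjPoints P)
  ProjPoints? P = all? (λ i → ¬? (all? λ j → P i j ≟ 0#)) ×-dec
    all? (λ i → all? λ i′ → ∀-dec enumeration
      (λ a≈b h P≈aP → h (λ j → trans (P≈aP j) (*-congʳ a≈b)))
      (λ a → all? (λ j → P i j ≟ (a ·v P i′) j) →-dec (i Fin.≟ i′)))

  ProIndependent? : ∀ {n M} k l (P : Fin M → Vecᴷ n) → Dec (ProIndependent k l P)
  ProIndependent? {M = M} k l P = ∀-dec (→-enumeration (Fin-enumeration M) k)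
    (λ {e} {e′} e≗e′ h e-injective →
      let (f , f-injective , indep) = h (InjectiveF-resp e≗e′ e-injective) in
      f , f-injective , LinIndep-to (λ i j → reflexive (≡.cong (λ t → P t j) (≡.sym (e≗e′ (f i))))) indep)
    (λ e → InjectiveF? e →-dec ∃-dec (→-enumeration (Fin-enumeration k) l)
      (λ {f} {f′} f≗f′ (f-injective , indep) → InjectiveF-resp f≗f′ f-injective ,
        LinIndep-to (λ i j → reflexive (≡.cong (λ t → P (e t) j) (f≗f′ i))) indep)
      (λ f → InjectiveF? f ×-dec LinIndep? (P ∘ e ∘ f)))

  HasIndependentSet? : ∀ n k l M → Dec (HasIndependentSet n k l M)
  HasIndependentSet? n k l M = ∃-dec (→-enumeration (vectors n) M)
    (λ P≈Q → IndependentSet-to P≈Q)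
    (λ P → ProjPoints? P ×-dec ProIndependent? k l P)

  -- Taking the scalar 1, distinct points have distinct representatives. The search wants only some
  -- bound, so vectors are counted rather than points.
  ProjPoints-bound : ∀ {n M} (P : Fin M → Vecᴷ n) → ProjPoints P → M ≤ q ℕ.^ n
  ProjPoints-bound {n} {M} P (_ , distinct) = injective⇒≤ {f = code} λ {i} {i′} eq →
    distinct i i′ 1# λ j → trans (element-index (P i j))
      (trans (reflexive (≡.cong element (decoded eq j)))
        (trans (sym (element-index (P i′ j))) (sym (*-identityˡ _))))
    where
    digits : Fin M → Fin n → Fin q
    digits i j = index (P i j)

    code : Fin M → Fin (q ℕ.^ n)
    code i = funToFin (digits i)

    decoded : ∀ {i i′} → code i ≡ code i′ → ∀ j → index (P i j) ≡ index (P i′ j)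
    decoded {i} {i′} eq j = ≡.trans (≡.sym (finToFun-funToFin (digits i) j))
      (≡.trans (≡.cong (λ t → finToFun t j) eq) (finToFun-funToFin (digits i′) j))

-- Strongly orthogonal sets and pro-independent sets

module PairIndependence {c ℓ} (F : Field c ℓ) where
  open Field F hiding (zero)
  open LinAlg F
  open FieldProperties F
  open GroupProperties +-group using (inverseˡ-unique)
  open RingProperties ring using (-‿distribˡ-*)
  open SetoidReasoning setoid

  solve-linear : ∀ {a a′ b x y} → a′ * a ≈ 1# → a * x + b * y ≈ 0# → x ≈ (a′ * - b) * y
  solve-linear {a} {a′} {b} {x} {y} a′a≈1 ax+by≈0 = begin
    x               ≈⟨ *-identityˡ x ⟨
    1# * x          ≈⟨ *-congʳ a′a≈1 ⟨
    a′ * a * x      ≈⟨ *-assoc a′ a x ⟩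
    a′ * (a * x)    ≈⟨ *-congˡ (inverseˡ-unique (a * x) (b * y) ax+by≈0) ⟩
    a′ * - (b * y)  ≈⟨ *-congˡ (-‿distribˡ-* b y) ⟩
    a′ * (- b * y)  ≈⟨ *-assoc a′ (- b) y ⟨
    a′ * - b * y    ∎

  -- A nonzero first coefficient could be divided out, making `w zero` a multiple of the other
  -- vector; once it is zero, the second coefficient annihilates a nonzero vector.
  pair-independent : (∀ x → Dec (x ≈ 0#)) → ∀ {n} (w : Fin 2 → Vecᴷ n) → NonZero (w (suc zero)) →
    (∀ a → ¬ w zero ≈v (a ·v w (suc zero))) → LinIndep w
  pair-independent _≟0 w w₁≉0 w₀≉aw₁ b comb≈0 = λ { zero → b₀≈0 ; (suc zero) → b₁≈0 }
    where
    b₀ b₁ : Carrier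
    b₀ = b zero
    b₁ = b (suc zero)

    comb : ∀ j → b₀ * w zero j + b₁ * w (suc zero) j ≈ 0#
    comb j = trans (+-congˡ (sym (+-identityʳ _))) (comb≈0 j)

    b₀≈0 : b₀ ≈ 0#
    b₀≈0 = decidable-stable (b₀ ≟0) λ b₀≉0 →
      let (b₀′ , b₀b₀′≈1) = inverse b₀ b₀≉0
      in w₀≉aw₁ (b₀′ * - b₁) λ j → solve-linear (trans (*-comm b₀′ b₀) b₀b₀′≈1) (comb j)

    b₁≈0 : b₁ ≈ 0#
    b₁≈0 = decidable-stable (b₁ ≟0) λ b₁≉0 → w₁≉0 λ j → zero-product b₁≉0 (begin
      b₁ * w (suc zero) j                     ≈⟨ +-identityˡ _ ⟨
      0# + b₁ * w (suc zero) j                ≈⟨ +-congʳ (trans (*-congʳ b₀≈0) (zeroˡ _)) ⟨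
      b₀ * w zero j + b₁ * w (suc zero) j     ≈⟨ comb j ⟩
      0#                                      ∎)

  not-multiple : ∀ {n} (w : Fin 2 → Vecᴷ n) → LinIndep w → ∀ a → ¬ w zero ≈v (a ·v w (suc zero))
  not-multiple w indep a w₀≈aw₁ = 1≉0 (indep coefficients cancels zero)
    where
    coefficients : Fin 2 → Carrier
    coefficients zero    = 1#
    coefficients (suc _) = - a

    cancels : lincomb 2 coefficients w ≈v 0v
    cancels j = begin
      1# * w zero j + (- a * w (suc zero) j + 0#)
        ≈⟨ +-cong (trans (*-identityˡ _) (w₀≈aw₁ j)) (+-identityʳ _) ⟩
      a * w (suc zero) j + - a * w (suc zero) j
        ≈⟨ +-congˡ (-‿distribˡ-* a _) ⟨
      a * w (suc zero) j - a * w (suc zero) j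
        ≈⟨ -‿inverseʳ _ ⟩
      0# ∎

module Correspondence {c ℓ} (K : Field c ℓ) (V : DiscreteValuation K) where
  open Field K hiding (zero)
  open Valued K V
  open LinAlg K
  open Valuation K V
  open Orthogonality K V
  private
    module κ where
      open Field residueField public
      open FieldProperties residueField public
      open LinAlg residueField public
      open ProjectiveIndependence residueField public
      open Projective residueField public
      open PairIndependence residueField public

  two : ∀ {M} → Fin M → Fin M → Fin 2 → Fin M
  two i i′ zero       = i
  two i i′ (suc zero) = i′

  HasStrongSet : ℕ → ℕ → ℕ → ℕ → Set (c ⊔ ℓ)
  HasStrongSet n k l M = ∃ λ (S : Fin M → Vecᴷ n) → Distinct S × StronglyOrthogonal k l S

  -- Weak orthogonality comes from the points being pairwise distinct, since two distinct points are
  -- independent; distinctness of the vectors is the case of scalar 1.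
  embed-strong : ∀ {n k l M} → κ.HasIndependentSet n k l M → HasStrongSet n k l M
  embed-strong {k = k} {l} {M} (P , (P≉0 , distinct) , indep) = S ,
    (λ i i′ eq → distinct i i′ κ.1# λ j → ≈⇒≈κ {P i j} {κ.1# κ.* P i′ j} (trans (eq j) (sym (*-identityˡ _)))) ,
    (λ i → embed-NonZero {u = P i} (P≉0 i)) ,
    -- Scaling by 1 only passes from `S ∘ two i i′` to `pair`, which agree pointwise but not
    -- definitionally.
    (λ i i′ i≢i′ → orthogonal-scale (λ _ → 1#) (λ _ → Field.0≉1 K ∘ sym)
      (λ { zero j → sym (*-identityˡ _) ; (suc zero) j → sym (*-identityˡ _) })
      (independent⇒orthogonal {us = P ∘ two i i′} (P≉0 ∘ two i i′)
        (κ.pair-independent (λ _ → _ ≤∞? _) (P ∘ two i i′) (P≉0 i′) (λ a → i≢i′ ∘ distinct i i′ a)))) ,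
    λ e e-injective → let (f , f-injective , f-indep) = indep e e-injective in
      f , f-injective , independent⇒orthogonal (λ i → P≉0 (e (f i))) f-indep
    where
    S : Fin M → Vecᴷ _
    S = embed ∘ P

  -- Weak orthogonality keeps the reductions of different vectors from being proportional, so no
  -- points are lost.
  reduce-strong : ∀ {n k l M} → HasStrongSet n k l M → κ.HasIndependentSet n k l M
  reduce-strong {n} {M = M} (S , _ , S≉0 , weak , strong) = P , (P≉0 , distinct) ,
    λ e e-injective → let (f , f-injective , orth) = strong e e-injective in
      f , f-injective , orthogonal⇒independent (λ i → P≉0 (e (f i)))
        (orthogonal-scale (λ i → a (e (f i))) (λ i → a≉0 (e (f i))) (λ i → P≈aS (e (f i))) orth)
    where
    N : ∀ i → _
    N i = normalize (S i) (S≉0 i)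

    a : Fin M → Carrier
    a i = proj₁ (N i)

    a≉0 : ∀ i → ¬ a i ≈ 0#
    a≉0 i = proj₁ (proj₂ (N i))

    P : Fin M → κ.Vecᴷ n
    P i = proj₁ (proj₂ (proj₂ (N i)))

    P≉0 : ∀ i → κ.NonZero (P i)
    P≉0 i = proj₁ (proj₂ (proj₂ (proj₂ (N i))))

    P≈aS : ∀ i j → embed (P i) j ≈ a i * S i j
    P≈aS i = proj₂ (proj₂ (proj₂ (proj₂ (N i))))

    distinct : ∀ i i′ b → P i κ.≈v (b κ.·v P i′) → i ≡ i′
    distinct i i′ b P≈bP = decidable-stable (i Fin.≟ i′) λ i≢i′ →
      κ.not-multiple (P ∘ two i i′)
        (orthogonal⇒independent {us = P ∘ two i i′} (P≉0 ∘ two i i′)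
          (orthogonal-scale (a ∘ two i i′) (a≉0 ∘ two i i′)
            (λ { zero → P≈aS i ; (suc zero) → P≈aS i′ }) (weak i i′ i≢i′)))
        b P≈bP

-- Existence of the common maximum

maxima-exist : ∀ {c₁ ℓ₁ c₂ ℓ₂} (K : Field c₁ ℓ₁) (V : DiscreteValuation K) (m : ℕ) →
  Valued.ResidueCard K V (2 ℕ.+ m) → (F : Field c₂ ℓ₂) → Projective.HasCard F (2 ℕ.+ m) →
  ∀ n k l → 1 ≤ k → ∃ λ N → Valued.IsΓ K V n k l N × Projective.IsIndPro F n k l N
maxima-exist K V m residueCard F card n (suc k) l _ =
  let (N , best , bound) = maximum (HasIndependentSet? n (suc k) l) empty (FiniteField.q F m card ℕ.^ n)
                             (λ M (P , points , _) → ProjPoints-bound P points)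
  in N , (embed-strong (HasIndependentSet-to best)
         , λ M S S-distinct S-strong → bound M (HasIndependentSet-from (reduce-strong (S , S-distinct , S-strong))))
       , (best , λ M P points indep → bound M (P , points , indep))
  where
  open Decidability F m card
  open Correspondence K V
  open Transport (Isomorphism.isomorphism F (Valuation.residueField K V) m card
    (Valuation.residueField-card K V residueCard))
  open ProjectiveIndependence F

  -- The starting point of the search: as k is positive, no k-tuple of indices exists and the
  -- condition is vacuous.
  empty : HasIndependentSet n (suc k) l 0
  empty = (λ ()) , ((λ ()) , λ ()) , λ e → ⊥-elim (no-point (e zero))
    where
    no-point : ¬ Fin 0
    no-point ()

-- With a single element, 0 and 1 would share a representative.
card≥2 : ∀ {c ℓ} (F : Field c ℓ) q → Projective.HasCard F q → ∃ λ m → q ≡ 2 ℕ.+ m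
card≥2 F zero    (e , cover , _) with () ← proj₁ (cover (Field.0# F))
card≥2 F (suc zero) (e , cover , _) =
  ⊥-elim (0≉1 (only _ _ (proj₂ (cover 0#)) (proj₂ (cover 1#))))
  where
  open Field F hiding (zero)
  only : ∀ (i j : Fin 1) → 0# ≈ e i → 1# ≈ e j → 0# ≈ 1#
  only zero zero 0≈e 1≈e = trans 0≈e (sym 1≈e)
card≥2 F (suc (suc m)) _ = m , ≡.refl

open import Data.Nat using (_*_; _∸_; _^_)

theorem1p22 : ∀ {c₁ ℓ₁ c₂ ℓ₂ : Level}
    (K : Field c₁ ℓ₁) (V : DiscreteValuation K) (q : ℕ) →
    Valued.ResidueCard K V q →
    (F : Field c₂ ℓ₂) → Projective.HasCard F q →
    (n k l : ℕ) → 2 ≤ l → l ≤ k → l ≤ n → k * (q ∸ 1) ≤ q ^ n ∸ 1 →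
    ∃ λ N → Valued.IsΓ K V n k l N × Projective.IsIndPro F n k l N
theorem1p22 K V q residueCard F card n k l 2≤l l≤k _ _ with card≥2 F q card
... | m , ≡.refl = maxima-exist K V m residueCard F card n k l
  (ℕ.≤-trans (ℕ.s≤s ℕ.z≤n) (ℕ.≤-trans 2≤l l≤k))
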